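{- Let $\mathcal{A}_G$ be the graphic arrangement in $\mathbb{K}^\ell$ of a simple graph $G$ with vertex set $[\ell]=\{1,\dots,\ell\}$. Let $R=\mathbb{K}[x_i-x_j\mid 1\le i<j\le\ell]\subset S=\mathbb{K}[x_1,\dots,x_\ell]$ and $$\Omega^1_R(\mathcal{A}_G)=\Omega^1(\mathcal{A}_G)\cap\Big(\bigoplus_{i=1}^\ell\frac{1}{Q(\mathcal{A}_G)}R\,dx_i\Big).$$ Then $$\Omega^1_R(\mathcal{A}_G)\cong J(G^c)/(x_1\cdots x_\ell)$$ as $R$-modules, where $G^c$ is the complementary graph of $G$ and $J(G^c)$ is its cover ideal.
   Context: Let $\mathbb{K}$ be a field, $V=\mathbb{K}^\ell$ and $S=\mathbb{K}[x_1,\dots,x_\ell]$, where $x_1,\dots,x_\ell$ are the coordinate functions. For a simple graph $G$ with vertex set $[\ell]$ and edge set $E(G)$, the graphic arrangement is $\mathcal{A}_G=\{\{x_u=x_v\}\mid\{u,v\}\in E(G)\}$. For a finite set $\mathcal{A}$ of linear hyperplanes in $V$, $\alpha_H\in V^*$ denotes a defining linear form of $H\in\mathcal{A}$ and $Q(\mathcal{A})=\prod_{H\in\mathcal{A}}\alpha_H$. For graphic arrangements take the defining forms $x_u-x_v$, so $Q(\mathcal{A}_G)\in R$. Let $\Omega_V^1=\bigoplus_i S\,dx_i$, $\Omega_V^2=\bigwedge^2\Omega_V^1$, and for $\alpha=\sum c_ix_i$ let $d\alpha=\sum c_i\,dx_i$. Define $$\Omega^1(\mathcal{A})=\{\omega\in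 \tfrac{1}{Q(\mathcal{A})}\Omega^1_V \mid Q(\mathcal{A})\,\omega\wedge d\alpha_H\in\alpha_H\Omega_V^2\ \text{for all } H\in\mathcal{A}\}.$$ The complementary graph $G^c$ has vertex set $[\ell]$ and its edges are the two-element subsets of $[\ell]$ that are not edges of $G$. The cover ideal of a graph $\Gamma$ on $[\ell]$ is the ideal $J(\Gamma)=\bigcap_{\{u,v\}\in E(\Gamma)}(x_u,x_v)$ of $S$ (equal to $S$ if $\Gamma$ has no edges). The $S$-module $J(G^c)/(x_1\cdots x_\ell)$ is viewed as an $R$-module via $R\subset S$. -}

module Defs where

open import Algebra.Bundles using (Ring; CommutativeRing; CommutativeMonoid; RawRing)
open import Algebra.Module.Bundles using (LeftModule; RawLeftModule)
import Algebra.Module.Construct.TensorUnit as TensorUnit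
import Algebra.Module.Morphism.LeftModuleMonomorphism as LeftModuleMono
open import Algebra.Module.Morphism.Structures using (IsLeftModuleMonomorphism; IsLeftModuleIsomorphism)
import Algebra.Morphism.RingMonomorphism as RingMono
open import Algebra.Morphism.Structures using (IsRingHomomorphism; IsRingMonomorphism)
import Algebra.Properties.AbelianGroup as AbelianGroupProperties
import Algebra.Properties.CommutativeMonoid.Sum as BigOperator
import Algebra.Properties.CommutativeSemigroup as CommutativeSemigroupProperties
import Algebra.Properties.Ring as RingProperties
import Algebra.Properties.Semiring.Sum as SemiringSum
import Algebra.Solver.Ring.NaturalCoefficients.Default as SemiringSolver
open import Data.Bool.Base using (if_then_else_)
open import Data.Fin.Base using (Fin; zero; suc; _<_)
open import Data.Fin.Properties using (_≟_; _<?_)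
open import Data.List.Base as List using (List; []; _∷_)
open import Data.List.Relation.Unary.All as All using (All)
open import Data.Nat.Base using (ℕ; zero; suc)
open import Data.Product.Base using (Σ; ∃; ∃-syntax; ∃₂; _×_; _,_; proj₁; proj₂)
open import Data.Vec.Functional as Vector using (Vector)
open import Function.Base using (_∘_; id)
open import Level using (Level; _⊔_; 0ℓ) renaming (suc to lsuc)
open import Relation.Binary.Bundles using (Setoid)
open import Relation.Binary.Core using (Rel)
open import Relation.Binary.Definitions using (Decidable; Symmetric; Irreflexive)
open import Relation.Binary.PropositionalEquality.Core using (_≡_; _≢_)
import Relation.Binary.PropositionalEquality.Core as ≡
import Relation.Binary.Reasoning.Setoid as SetoidReasoning
open import Relation.Nullary.Decidable.Core using (does; _×-dec_; ¬?)
open import Relation.Nullary.Negation.Core using (¬_)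
open import Relation.Unary using (Pred; _⊆_)

------------------------------------------------------------------------
-- Polynomials

-- A univariate polynomial is its list of coefficients, constant term first;
-- trailing zeros are ignored by the equality.
module Univariate {c ℓ : Level} (A : CommutativeRing c ℓ) where

  open CommutativeRing A hiding (zero)
  open SetoidReasoning setoid
  private
    module RP = RingProperties ring
    module SG = CommutativeSemigroupProperties +-commutativeSemigroup

  coeff : List Carrier → ℕ → Carrier
  coeff []      n       = 0#
  coeff (a ∷ p) zero    = a
  coeff (a ∷ p) (suc n) = coeff p n

  infix 4 _≋_
  record _≋_ (p q : List Carrier) : Set ℓ where
    constructor mk≋
    field at : ∀ n → coeff p n ≈ coeff q n
  open _≋_ public

  infixl 6 _⊕_
  infixl 7 _⊛_
  infixr 7 _·_
  infix  8 ⊖_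

  _⊕_ : List Carrier → List Carrier → List Carrier
  []      ⊕ q       = q
  (a ∷ p) ⊕ []      = a ∷ p
  (a ∷ p) ⊕ (b ∷ q) = (a + b) ∷ (p ⊕ q)

  ⊖_ : List Carrier → List Carrier
  ⊖_ = List.map (-_)

  _·_ : Carrier → List Carrier → List Carrier
  a · p = List.map (a *_) p

  -- (a + t p) q = a q + t (p q)
  _⊛_ : List Carrier → List Carrier → List Carrier
  []      ⊛ q = []
  (a ∷ p) ⊛ q = (a · q) ⊕ (0# ∷ (p ⊛ q))

  coeff-⊕ : ∀ p q n → coeff (p ⊕ q) n ≈ coeff p n + coeff q n
  coeff-⊕ []      q       n       = sym (+-identityˡ _)
  coeff-⊕ (a ∷ p) []      n       = sym (+-identityʳ _)
  coeff-⊕ (a ∷ p) (b ∷ q) zero    = refl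
  coeff-⊕ (a ∷ p) (b ∷ q) (suc n) = coeff-⊕ p q n

  coeff-⊖ : ∀ p n → coeff (⊖ p) n ≈ - coeff p n
  coeff-⊖ []      n       = sym RP.-0#≈0#
  coeff-⊖ (a ∷ p) zero    = refl
  coeff-⊖ (a ∷ p) (suc n) = coeff-⊖ p n

  coeff-· : ∀ a p n → coeff (a · p) n ≈ a * coeff p n
  coeff-· a []      n       = sym (zeroʳ a)
  coeff-· a (b ∷ p) zero    = refl
  coeff-· a (b ∷ p) (suc n) = coeff-· a p n

  ≋-refl : ∀ {p} → p ≋ p
  ≋-refl = mk≋ λ _ → refl

  ≋-sym : ∀ {p q} → p ≋ q → q ≋ p
  ≋-sym e = mk≋ λ n → sym (at e n)

  ≋-trans : ∀ {p q r} → p ≋ q → q ≋ r → p ≋ r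
  ≋-trans e f = mk≋ λ n → trans (at e n) (at f n)

  ≋-setoid : Setoid c ℓ
  ≋-setoid = record
    { _≈_ = _≋_
    ; isEquivalence = record { refl = ≋-refl ; sym = ≋-sym ; trans = ≋-trans }
    }

  private module L = SetoidReasoning ≋-setoid

  ∷-cong : ∀ {a b p q} → a ≈ b → p ≋ q → (a ∷ p) ≋ (b ∷ q)
  ∷-cong e f = mk≋ λ { zero → e ; (suc n) → at f n }

  ⊕-cong : ∀ {p p′ q q′} → p ≋ p′ → q ≋ q′ → p ⊕ q ≋ p′ ⊕ q′
  ⊕-cong {p} {p′} {q} {q′} e f = mk≋ λ n →
    trans (coeff-⊕ p q n) (trans (+-cong (at e n) (at f n)) (sym (coeff-⊕ p′ q′ n)))

  ⊕-assoc : ∀ p q r → (p ⊕ q) ⊕ r ≋ p ⊕ (q ⊕ r)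
  ⊕-assoc p q r = mk≋ λ n → begin
    coeff ((p ⊕ q) ⊕ r) n                 ≈⟨ coeff-⊕ (p ⊕ q) r n ⟩
    coeff (p ⊕ q) n + coeff r n           ≈⟨ +-congʳ (coeff-⊕ p q n) ⟩
    (coeff p n + coeff q n) + coeff r n   ≈⟨ +-assoc _ _ _ ⟩
    coeff p n + (coeff q n + coeff r n)   ≈⟨ +-congˡ (coeff-⊕ q r n) ⟨
    coeff p n + coeff (q ⊕ r) n           ≈⟨ coeff-⊕ p (q ⊕ r) n ⟨
    coeff (p ⊕ (q ⊕ r)) n                 ∎

  ⊕-comm : ∀ p q → p ⊕ q ≋ q ⊕ p
  ⊕-comm p q = mk≋ λ n →
    trans (coeff-⊕ p q n) (trans (+-comm _ _) (sym (coeff-⊕ q p n)))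

  ⊕-identityʳ : ∀ p → p ⊕ [] ≋ p
  ⊕-identityʳ p = ⊕-comm p []

  ⊖-cong : ∀ {p q} → p ≋ q → ⊖ p ≋ ⊖ q
  ⊖-cong {p} {q} e = mk≋ λ n →
    trans (coeff-⊖ p n) (trans (-‿cong (at e n)) (sym (coeff-⊖ q n)))

  ⊖-inverseˡ : ∀ p → ⊖ p ⊕ p ≋ []
  ⊖-inverseˡ p = mk≋ λ n →
    trans (coeff-⊕ (⊖ p) p n) (trans (+-congʳ (coeff-⊖ p n)) (-‿inverseˡ _))

  ⊖-inverseʳ : ∀ p → p ⊕ ⊖ p ≋ []
  ⊖-inverseʳ p = ≋-trans (⊕-comm p (⊖ p)) (⊖-inverseˡ p)

  ⊕-interchange : ∀ p q r s → (p ⊕ q) ⊕ (r ⊕ s) ≋ (p ⊕ r) ⊕ (q ⊕ s)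
  ⊕-interchange p q r s = mk≋ λ n → begin
    coeff ((p ⊕ q) ⊕ (r ⊕ s)) n
      ≈⟨ trans (coeff-⊕ (p ⊕ q) (r ⊕ s) n) (+-cong (coeff-⊕ p q n) (coeff-⊕ r s n)) ⟩
    (coeff p n + coeff q n) + (coeff r n + coeff s n)
      ≈⟨ SG.interchange _ _ _ _ ⟩
    (coeff p n + coeff r n) + (coeff q n + coeff s n)
      ≈⟨ trans (coeff-⊕ (p ⊕ r) (q ⊕ s) n) (+-cong (coeff-⊕ p r n) (coeff-⊕ q s n)) ⟨
    coeff ((p ⊕ r) ⊕ (q ⊕ s)) n ∎

  ·-cong : ∀ {a b p q} → a ≈ b → p ≋ q → a · p ≋ b · q
  ·-cong {a} {b} {p} {q} e f = mk≋ λ n →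
    trans (coeff-· a p n) (trans (*-cong e (at f n)) (sym (coeff-· b q n)))

  ·-zero : ∀ {a} p → a ≈ 0# → a · p ≋ []
  ·-zero {a} p e = mk≋ λ n →
    trans (coeff-· a p n) (trans (*-congʳ e) (zeroˡ _))

  ·-distrib-⊕ : ∀ a p q → a · (p ⊕ q) ≋ a · p ⊕ a · q
  ·-distrib-⊕ a p q = mk≋ λ n → begin
    coeff (a · (p ⊕ q)) n               ≈⟨ coeff-· a (p ⊕ q) n ⟩
    a * coeff (p ⊕ q) n                 ≈⟨ *-congˡ (coeff-⊕ p q n) ⟩
    a * (coeff p n + coeff q n)         ≈⟨ distribˡ _ _ _ ⟩
    a * coeff p n + a * coeff q n       ≈⟨ +-cong (coeff-· a p n) (coeff-· a q n) ⟨
    coeff (a · p) n + coeff (a · q) n   ≈⟨ coeff-⊕ (a · p) (a · q) n ⟨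
    coeff (a · p ⊕ a · q) n             ∎

  ·-distrib-+ : ∀ a b p → (a + b) · p ≋ a · p ⊕ b · p
  ·-distrib-+ a b p = mk≋ λ n → begin
    coeff ((a + b) · p) n               ≈⟨ coeff-· (a + b) p n ⟩
    (a + b) * coeff p n                 ≈⟨ distribʳ _ _ _ ⟩
    a * coeff p n + b * coeff p n       ≈⟨ +-cong (coeff-· a p n) (coeff-· b p n) ⟨
    coeff (a · p) n + coeff (b · p) n   ≈⟨ coeff-⊕ (a · p) (b · p) n ⟨
    coeff (a · p ⊕ b · p) n             ∎

  ·-assoc : ∀ a b p → (a * b) · p ≋ a · (b · p)
  ·-assoc a b p = mk≋ λ n → begin
    coeff ((a * b) · p) n   ≈⟨ coeff-· (a * b) p n ⟩
    (a * b) * coeff p n     ≈⟨ *-assoc _ _ _ ⟩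
    a * (b * coeff p n)     ≈⟨ *-congˡ (coeff-· b p n) ⟨
    a * coeff (b · p) n     ≈⟨ coeff-· a (b · p) n ⟨
    coeff (a · (b · p)) n   ∎

  ·-identity : ∀ p → 1# · p ≋ p
  ·-identity p = mk≋ λ n → trans (coeff-· 1# p n) (*-identityˡ _)

  0∷-zero : ∀ {p} → p ≋ [] → (0# ∷ p) ≋ []
  0∷-zero e = mk≋ λ { zero → refl ; (suc n) → at e n }

  ⊛-zeroˡ : ∀ p q → p ≋ [] → p ⊛ q ≋ []
  ⊛-zeroˡ []      q e = ≋-refl
  ⊛-zeroˡ (a ∷ p) q e =
    ⊕-cong (·-zero q (at e zero)) (0∷-zero (⊛-zeroˡ p q (mk≋ λ n → at e (suc n))))

  ⊛-cong : ∀ {p p′ q q′} → p ≋ p′ → q ≋ q′ → p ⊛ q ≋ p′ ⊛ q′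
  ⊛-cong {[]}    {p′}      {q} {q′} e f = ≋-sym (⊛-zeroˡ p′ q′ (≋-sym e))
  ⊛-cong {a ∷ p} {[]}      {q} {q′} e f = ⊛-zeroˡ (a ∷ p) q e
  ⊛-cong {a ∷ p} {a′ ∷ p′} {q} {q′} e f =
    ⊕-cong (·-cong (at e zero) f) (∷-cong refl (⊛-cong {p} {p′} (mk≋ λ n → at e (suc n)) f))

  ⊛-distribʳ : ∀ r p q → (p ⊕ q) ⊛ r ≋ (p ⊛ r) ⊕ (q ⊛ r)
  ⊛-distribʳ r []      q       = ≋-refl
  ⊛-distribʳ r (a ∷ p) []      = ≋-sym (⊕-identityʳ _)
  ⊛-distribʳ r (a ∷ p) (b ∷ q) = L.begin
    (a + b) · r ⊕ (0# ∷ ((p ⊕ q) ⊛ r))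
      L.≈⟨ ⊕-cong (·-distrib-+ a b r) (∷-cong (sym (+-identityˡ 0#)) (⊛-distribʳ r p q)) ⟩
    (a · r ⊕ b · r) ⊕ ((0# ∷ (p ⊛ r)) ⊕ (0# ∷ (q ⊛ r)))
      L.≈⟨ ⊕-interchange (a · r) (b · r) (0# ∷ (p ⊛ r)) (0# ∷ (q ⊛ r)) ⟩
    ((a ∷ p) ⊛ r) ⊕ ((b ∷ q) ⊛ r) L.∎

  ⊛-zeroʳ : ∀ p → p ⊛ [] ≋ []
  ⊛-zeroʳ []      = ≋-refl
  ⊛-zeroʳ (a ∷ p) = 0∷-zero (⊛-zeroʳ p)

  ⊛-∷ʳ : ∀ p b q → p ⊛ (b ∷ q) ≋ b · p ⊕ (0# ∷ (p ⊛ q))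
  ⊛-∷ʳ []      b q = mk≋ λ { zero → refl ; (suc n) → refl }
  ⊛-∷ʳ (a ∷ p) b q = ∷-cong (+-congʳ (*-comm a b)) (L.begin
    a · q ⊕ (p ⊛ (b ∷ q))            L.≈⟨ ⊕-cong ≋-refl (⊛-∷ʳ p b q) ⟩
    a · q ⊕ (b · p ⊕ (0# ∷ (p ⊛ q))) L.≈⟨ ⊕-assoc (a · q) (b · p) _ ⟨
    (a · q ⊕ b · p) ⊕ (0# ∷ (p ⊛ q)) L.≈⟨ ⊕-cong (⊕-comm (a · q) (b · p)) ≋-refl ⟩
    (b · p ⊕ a · q) ⊕ (0# ∷ (p ⊛ q)) L.≈⟨ ⊕-assoc (b · p) (a · q) _ ⟩
    b · p ⊕ ((a ∷ p) ⊛ q)            L.∎)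

  ⊛-comm : ∀ p q → p ⊛ q ≋ q ⊛ p
  ⊛-comm []      q = ≋-sym (⊛-zeroʳ q)
  ⊛-comm (a ∷ p) q =
    ≋-trans (⊕-cong (≋-refl {a · q}) (∷-cong refl (⊛-comm p q))) (≋-sym (⊛-∷ʳ q a p))

  ⊛-distribˡ : ∀ r p q → r ⊛ (p ⊕ q) ≋ (r ⊛ p) ⊕ (r ⊛ q)
  ⊛-distribˡ r p q = ≋-trans (⊛-comm r (p ⊕ q))
    (≋-trans (⊛-distribʳ r p q) (⊕-cong (⊛-comm p r) (⊛-comm q r)))

  ·-⊛ : ∀ a p q → (a · p) ⊛ q ≋ a · (p ⊛ q)
  ·-⊛ a []      q = ≋-refl
  ·-⊛ a (b ∷ p) q = L.begin
    (a * b) · q ⊕ (0# ∷ ((a · p) ⊛ q))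
      L.≈⟨ ⊕-cong (·-assoc a b q) (∷-cong (sym (zeroʳ a)) (·-⊛ a p q)) ⟩
    a · (b · q) ⊕ a · (0# ∷ (p ⊛ q))
      L.≈⟨ ·-distrib-⊕ a (b · q) (0# ∷ (p ⊛ q)) ⟨
    a · ((b ∷ p) ⊛ q) L.∎

  ⊛-assoc : ∀ p q r → (p ⊛ q) ⊛ r ≋ p ⊛ (q ⊛ r)
  ⊛-assoc []      q r = ≋-refl
  ⊛-assoc (a ∷ p) q r = L.begin
    (a · q ⊕ (0# ∷ (p ⊛ q))) ⊛ r
      L.≈⟨ ⊛-distribʳ r (a · q) (0# ∷ (p ⊛ q)) ⟩
    ((a · q) ⊛ r) ⊕ (0# · r ⊕ (0# ∷ ((p ⊛ q) ⊛ r)))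
      L.≈⟨ ⊕-cong (·-⊛ a q r) (⊕-cong (·-zero r refl) (∷-cong refl (⊛-assoc p q r))) ⟩
    (a ∷ p) ⊛ (q ⊛ r) L.∎

  ⊛-identityˡ : ∀ p → (1# ∷ []) ⊛ p ≋ p
  ⊛-identityˡ p =
    ≋-trans (⊕-cong (·-identity p) (0∷-zero ≋-refl)) (⊕-identityʳ p)

  polynomialRing : CommutativeRing c ℓ
  polynomialRing = record
    { Carrier = List Carrier
    ; _≈_ = _≋_
    ; _+_ = _⊕_
    ; _*_ = _⊛_
    ; -_  = ⊖_
    ; 0#  = []
    ; 1#  = 1# ∷ []
    ; isCommutativeRing = record
      { isRing = record
        { +-isAbelianGroup = record
          { isGroup = record
            { isMonoid = record
              { isSemigroup = record
                { isMagma = record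
                  { isEquivalence = Setoid.isEquivalence ≋-setoid
                  ; ∙-cong = ⊕-cong
                  }
                ; assoc = ⊕-assoc
                }
              ; identity = (λ _ → ≋-refl) , ⊕-identityʳ
              }
            ; inverse = ⊖-inverseˡ , ⊖-inverseʳ
            ; ⁻¹-cong = ⊖-cong
            }
          ; comm = ⊕-comm
          }
        ; *-cong = ⊛-cong
        ; *-assoc = ⊛-assoc
        ; *-identity = ⊛-identityˡ , λ p → ≋-trans (⊛-comm p (1# ∷ [])) (⊛-identityˡ p)
        ; distrib = ⊛-distribˡ , ⊛-distribʳ
        }
      ; *-comm = ⊛-comm
      }
    }

module _ {c ℓ : Level} (A : CommutativeRing c ℓ) where

  -- A[x₀,…,xₙ] is A[x₁,…,xₙ][x₀].
  Polynomials : ℕ → CommutativeRing c ℓ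
  Polynomials zero    = A
  Polynomials (suc n) = Univariate.polynomialRing (Polynomials n)

  const : ∀ n → CommutativeRing.Carrier A → CommutativeRing.Carrier (Polynomials n)
  const zero    a = a
  const (suc n) a = const n a ∷ []

  var : ∀ {n} → Fin n → CommutativeRing.Carrier (Polynomials n)
  var {suc n} zero    = 0# ∷ 1# ∷ []
    where open CommutativeRing (Polynomials n)
  var {suc n} (suc i) = var i ∷ []

------------------------------------------------------------------------
-- Total ring of fractions

-- For a domain the regular elements are the nonzero ones, so that for a
-- polynomial ring over a field this is the field of rational functions.
module Fractions {c ℓ : Level} (S : CommutativeRing c ℓ) where

  open CommutativeRing S
  open SetoidReasoning setoid
  open SemiringSolver commutativeSemiring using (solve; _:+_; _:*_; _:=_)
  private module RP = RingProperties ring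

  Regular : Carrier → Set (c ⊔ ℓ)
  Regular s = ∀ {a b} → s * a ≈ s * b → a ≈ b

  1-regular : Regular 1#
  1-regular e = trans (sym (*-identityˡ _)) (trans e (*-identityˡ _))

  *-regular : ∀ {s t} → Regular s → Regular t → Regular (s * t)
  *-regular rs rt e = rt (rs (trans (sym (*-assoc _ _ _)) (trans e (*-assoc _ _ _))))

  record Fraction : Set (c ⊔ ℓ) where
    constructor fraction
    field
      num     : Carrier
      den     : Carrier
      regular : Regular den
  open Fraction public

  infix  4 _≃_
  infixl 6 _⊕_
  infixl 7 _⊛_
  infix  8 ⊖_

  record _≃_ (x y : Fraction) : Set ℓ where
    constructor mk≃
    field cross : num x * den y ≈ num y * den x
  open _≃_ public

  _⊕_ : Fraction → Fraction → Fraction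
  x ⊕ y = fraction (num x * den y + num y * den x) (den x * den y)
                   (*-regular (regular x) (regular y))

  _⊛_ : Fraction → Fraction → Fraction
  x ⊛ y = fraction (num x * num y) (den x * den y) (*-regular (regular x) (regular y))

  ⊖_ : Fraction → Fraction
  ⊖ x = fraction (- num x) (den x) (regular x)

  ι : Carrier → Fraction
  ι a = fraction a 1# 1-regular

  ≃-refl : ∀ {x} → x ≃ x
  ≃-refl = mk≃ refl

  ≃-sym : ∀ {x y} → x ≃ y → y ≃ x
  ≃-sym e = mk≃ (sym (cross e))

  ≃-trans : ∀ {x y z} → x ≃ y → y ≃ z → x ≃ z
  ≃-trans {x} {y} {z} e f = mk≃ (regular y (begin
    den y * (num x * den z)   ≈⟨ rot (den y) (num x) (den z) ⟩
    (num x * den y) * den z   ≈⟨ *-congʳ (cross e) ⟩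
    (num y * den x) * den z   ≈⟨ swap (num y) (den x) (den z) ⟩
    (num y * den z) * den x   ≈⟨ *-congʳ (cross f) ⟩
    (num z * den y) * den x   ≈⟨ rot (den y) (num z) (den x) ⟨
    den y * (num z * den x)   ∎))
    where
    rot : ∀ a b d → a * (b * d) ≈ (b * a) * d
    rot = solve 3 (λ a b d → a :* (b :* d) := (b :* a) :* d) refl
    swap : ∀ a b d → (a * b) * d ≈ (a * d) * b
    swap = solve 3 (λ a b d → (a :* b) :* d := (a :* d) :* b) refl

  ⊕-cong : ∀ {x x′ y y′} → x ≃ x′ → y ≃ y′ → x ⊕ y ≃ x′ ⊕ y′
  ⊕-cong {fraction a s _} {fraction a′ s′ _} {fraction b t _} {fraction b′ t′ _} e f =
    mk≃ (begin
      (a * t + b * s) * (s′ * t′)               ≈⟨ expand a s s′ b t t′ ⟩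
      (a * s′) * (t * t′) + (b * t′) * (s * s′) ≈⟨ +-cong (*-congʳ (cross e)) (*-congʳ (cross f)) ⟩
      (a′ * s) * (t * t′) + (b′ * t) * (s * s′) ≈⟨ collect a′ s s′ b′ t t′ ⟨
      (a′ * t′ + b′ * s′) * (s * t)             ∎)
    where
    expand : ∀ a s s′ b t t′ →
      (a * t + b * s) * (s′ * t′) ≈ (a * s′) * (t * t′) + (b * t′) * (s * s′)
    expand = solve 6 (λ a s s′ b t t′ → (a :* t :+ b :* s) :* (s′ :* t′) :=
      (a :* s′) :* (t :* t′) :+ (b :* t′) :* (s :* s′)) refl
    collect : ∀ a′ s s′ b′ t t′ →
      (a′ * t′ + b′ * s′) * (s * t) ≈ (a′ * s) * (t * t′) + (b′ * t) * (s * s′)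
    collect = solve 6 (λ a′ s s′ b′ t t′ → (a′ :* t′ :+ b′ :* s′) :* (s :* t) :=
      (a′ :* s) :* (t :* t′) :+ (b′ :* t) :* (s :* s′)) refl

  ⊛-cong : ∀ {x x′ y y′} → x ≃ x′ → y ≃ y′ → x ⊛ y ≃ x′ ⊛ y′
  ⊛-cong {fraction a s _} {fraction a′ s′ _} {fraction b t _} {fraction b′ t′ _} e f =
    mk≃ (begin
      (a * b) * (s′ * t′)   ≈⟨ medial a b s′ t′ ⟩
      (a * s′) * (b * t′)   ≈⟨ *-cong (cross e) (cross f) ⟩
      (a′ * s) * (b′ * t)   ≈⟨ medial a′ b′ s t ⟨
      (a′ * b′) * (s * t)   ∎)
    where
    medial : ∀ a b d e → (a * b) * (d * e) ≈ (a * d) * (b * e)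
    medial = solve 4 (λ a b d e → (a :* b) :* (d :* e) := (a :* d) :* (b :* e)) refl

  ⊖-cong : ∀ {x y} → x ≃ y → ⊖ x ≃ ⊖ y
  ⊖-cong {x} {y} e = mk≃ (begin
    - num x * den y     ≈⟨ RP.-‿distribˡ-* _ _ ⟨
    - (num x * den y)   ≈⟨ -‿cong (cross e) ⟩
    - (num y * den x)   ≈⟨ RP.-‿distribˡ-* _ _ ⟩
    - num y * den x     ∎)

  ⊕-comm : ∀ x y → x ⊕ y ≃ y ⊕ x
  ⊕-comm x y = mk≃ (*-cong (+-comm _ _) (*-comm _ _))

  ⊛-comm : ∀ x y → x ⊛ y ≃ y ⊛ x
  ⊛-comm x y = mk≃ (*-cong (*-comm _ _) (*-comm _ _))

  ⊕-assoc : ∀ x y z → (x ⊕ y) ⊕ z ≃ x ⊕ (y ⊕ z)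
  ⊕-assoc (fraction a s _) (fraction b t _) (fraction d r _) = mk≃
    (solve 6 (λ a s b t d r →
      ((a :* t :+ b :* s) :* r :+ d :* (s :* t)) :* (s :* (t :* r)) :=
      (a :* (t :* r) :+ (b :* r :+ d :* t) :* s) :* ((s :* t) :* r)) refl a s b t d r)

  ⊛-assoc : ∀ x y z → (x ⊛ y) ⊛ z ≃ x ⊛ (y ⊛ z)
  ⊛-assoc x y z = mk≃ (*-cong (*-assoc _ _ _) (sym (*-assoc _ _ _)))

  ⊕-identityˡ : ∀ x → ι 0# ⊕ x ≃ x
  ⊕-identityˡ x = mk≃ (*-cong
    (trans (+-cong (zeroˡ _) (*-identityʳ _)) (+-identityˡ _))
    (sym (*-identityˡ _)))

  ⊛-identityˡ : ∀ x → ι 1# ⊛ x ≃ x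
  ⊛-identityˡ x = mk≃ (*-cong (*-identityˡ _) (sym (*-identityˡ _)))

  ⊖-inverseˡ : ∀ x → ⊖ x ⊕ x ≃ ι 0#
  ⊖-inverseˡ x = mk≃ (begin
    (- num x * den x + num x * den x) * 1#  ≈⟨ *-identityʳ _ ⟩
    - num x * den x + num x * den x         ≈⟨ distribʳ _ _ _ ⟨
    (- num x + num x) * den x               ≈⟨ *-congʳ (-‿inverseˡ _) ⟩
    0# * den x                              ≈⟨ zeroˡ _ ⟩
    0#                                      ≈⟨ zeroˡ _ ⟨
    0# * (den x * den x)                    ∎)

  ⊛-distribʳ : ∀ z x y → (x ⊕ y) ⊛ z ≃ (x ⊛ z) ⊕ (y ⊛ z)
  ⊛-distribʳ (fraction d r _) (fraction a s _) (fraction b t _) = mk≃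
    (solve 6 (λ a s b t d r →
      ((a :* t :+ b :* s) :* d) :* ((s :* r) :* (t :* r)) :=
      ((a :* d) :* (t :* r) :+ (b :* d) :* (s :* r)) :* ((s :* t) :* r)) refl a s b t d r)

  fractionRing : CommutativeRing (c ⊔ ℓ) ℓ
  fractionRing = record
    { Carrier = Fraction
    ; _≈_ = _≃_
    ; _+_ = _⊕_
    ; _*_ = _⊛_
    ; -_  = ⊖_
    ; 0#  = ι 0#
    ; 1#  = ι 1#
    ; isCommutativeRing = record
      { isRing = record
        { +-isAbelianGroup = record
          { isGroup = record
            { isMonoid = record
              { isSemigroup = record
                { isMagma = record
                  { isEquivalence = record { refl = ≃-refl ; sym = ≃-sym ; trans = ≃-trans }
                  ; ∙-cong = ⊕-cong
                  }
                ; assoc = ⊕-assoc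
                }
              ; identity = ⊕-identityˡ , λ x → ≃-trans (⊕-comm x (ι 0#)) (⊕-identityˡ x)
              }
            ; inverse = ⊖-inverseˡ , λ x → ≃-trans (⊕-comm x (⊖ x)) (⊖-inverseˡ x)
            ; ⁻¹-cong = ⊖-cong
            }
          ; comm = ⊕-comm
          }
        ; *-cong = ⊛-cong
        ; *-assoc = ⊛-assoc
        ; *-identity = ⊛-identityˡ , λ x → ≃-trans (⊛-comm x (ι 1#)) (⊛-identityˡ x)
        ; distrib = (λ z x y → ≃-trans (⊛-comm z (x ⊕ y))
                      (≃-trans (⊛-distribʳ z x y) (⊕-cong (⊛-comm x z) (⊛-comm y z))))
                  , ⊛-distribʳ
        }
      ; *-comm = ⊛-comm
      }
    }

  ι-isRingHomomorphism :
    IsRingHomomorphism rawRing (CommutativeRing.rawRing fractionRing) ι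
  ι-isRingHomomorphism = record
    { isSemiringHomomorphism = record
      { isNearSemiringHomomorphism = record
        { +-isMonoidHomomorphism = record
          { isMagmaHomomorphism = record
            { isRelHomomorphism = record { cong = λ e → mk≃ (*-congʳ e) }
            ; homo = λ a b → mk≃ (*-cong
                (sym (+-cong (*-identityʳ a) (*-identityʳ b))) (*-identityʳ 1#))
            }
          ; ε-homo = ≃-refl
          }
        ; *-homo = λ a b → mk≃ (*-congˡ (*-identityʳ 1#))
        }
      ; 1#-homo = ≃-refl
      }
    ; -‿homo = λ a → ≃-refl
    }

------------------------------------------------------------------------
-- Subrings

module Subrings {c ℓ : Level} (S : CommutativeRing c ℓ) where

  open CommutativeRing S

  record Subring p : Set (c ⊔ ℓ ⊔ lsuc p) where
    infix 4 _∈
    field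
      _∈     : Pred Carrier p
      resp   : ∀ {a b} → a ≈ b → a ∈ → b ∈
      0∈     : 0# ∈
      1∈     : 1# ∈
      +-∈    : ∀ {a b} → a ∈ → b ∈ → (a + b) ∈
      *-∈    : ∀ {a b} → a ∈ → b ∈ → (a * b) ∈
      neg-∈  : ∀ {a} → a ∈ → (- a) ∈

    private
      raw : RawRing (c ⊔ p) ℓ
      raw = record
        { Carrier = Σ Carrier _∈
        ; _≈_ = λ a b → proj₁ a ≈ proj₁ b
        ; _+_ = λ a b → proj₁ a + proj₁ b , +-∈ (proj₂ a) (proj₂ b)
        ; _*_ = λ a b → proj₁ a * proj₁ b , *-∈ (proj₂ a) (proj₂ b)
        ; -_  = λ a → - proj₁ a , neg-∈ (proj₂ a)
        ; 0#  = 0# , 0∈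
        ; 1#  = 1# , 1∈
        }

      mono : IsRingMonomorphism raw rawRing proj₁
      mono = record
        { isRingHomomorphism = record
          { isSemiringHomomorphism = record
            { isNearSemiringHomomorphism = record
              { +-isMonoidHomomorphism = record
                { isMagmaHomomorphism = record
                  { isRelHomomorphism = record { cong = id }
                  ; homo = λ _ _ → refl
                  }
                ; ε-homo = refl
                }
              ; *-homo = λ _ _ → refl
              }
            ; 1#-homo = refl
            }
          ; -‿homo = λ _ → refl
          }
        ; injective = id
        }

    commutativeRing : CommutativeRing (c ⊔ p) ℓ
    commutativeRing = record
      { isCommutativeRing = RingMono.isCommutativeRing mono isCommutativeRing }

    inclusion : IsRingHomomorphism (CommutativeRing.rawRing commutativeRing) rawRing proj₁
    inclusion = IsRingMonomorphism.isRingHomomorphism mono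

  data Generated {g} (G : Pred Carrier g) : Pred Carrier (c ⊔ ℓ ⊔ g) where
    gen   : ∀ {a} → G a → Generated G a
    resp  : ∀ {a b} → a ≈ b → Generated G a → Generated G b
    0∈    : Generated G 0#
    1∈    : Generated G 1#
    +-∈   : ∀ {a b} → Generated G a → Generated G b → Generated G (a + b)
    *-∈   : ∀ {a b} → Generated G a → Generated G b → Generated G (a * b)
    neg-∈ : ∀ {a} → Generated G a → Generated G (- a)

  generatedSubring : ∀ {g} → Pred Carrier g → Subring (c ⊔ ℓ ⊔ g)
  generatedSubring G = record
    { _∈ = Generated G ; resp = resp ; 0∈ = 0∈ ; 1∈ = 1∈ ; +-∈ = +-∈ ; *-∈ = *-∈ ; neg-∈ = neg-∈ }

------------------------------------------------------------------------
-- Modules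

module _ {r ℓr : Level} {R : Ring r ℓr} where

  infix 4 _≅_
  _≅_ : ∀ {m ℓm m′ ℓm′} → LeftModule R m ℓm → LeftModule R m′ ℓm′ →
        Set (r ⊔ m ⊔ ℓm ⊔ m′ ⊔ ℓm′)
  M ≅ N = ∃ (IsLeftModuleIsomorphism (LeftModule.rawLeftModule M) (LeftModule.rawLeftModule N))

  power : ∀ {m ℓm i} → LeftModule R m ℓm → Set i → LeftModule R (i ⊔ m) (i ⊔ ℓm)
  power M I = record
    { Carrierᴹ = I → Carrierᴹ
    ; _≈ᴹ_ = λ f g → ∀ i → f i ≈ᴹ g i
    ; _+ᴹ_ = λ f g i → f i +ᴹ g i
    ; _*ₗ_ = λ s f i → s *ₗ f i
    ; 0ᴹ   = λ _ → 0ᴹ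
    ; -ᴹ_  = λ f i → -ᴹ f i
    ; isLeftModule = record
      { isLeftSemimodule = record
        { +ᴹ-isCommutativeMonoid = record
          { isMonoid = record
            { isSemigroup = record
              { isMagma = record
                { isEquivalence = record
                  { refl = λ _ → ≈ᴹ-refl
                  ; sym = λ e i → ≈ᴹ-sym (e i)
                  ; trans = λ e f i → ≈ᴹ-trans (e i) (f i)
                  }
                ; ∙-cong = λ e f i → +ᴹ-cong (e i) (f i)
                }
              ; assoc = λ f g h i → +ᴹ-assoc (f i) (g i) (h i)
              }
            ; identity = (λ f i → +ᴹ-identityˡ (f i)) , (λ f i → +ᴹ-identityʳ (f i))
            }
          ; comm = λ f g i → +ᴹ-comm (f i) (g i)
          }
        ; isPreleftSemimodule = record
          { *ₗ-cong = λ e f i → *ₗ-cong e (f i)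
          ; *ₗ-zeroˡ = λ f i → *ₗ-zeroˡ (f i)
          ; *ₗ-distribʳ = λ f s t i → *ₗ-distribʳ (f i) s t
          ; *ₗ-identityˡ = λ f i → *ₗ-identityˡ (f i)
          ; *ₗ-assoc = λ s t f i → *ₗ-assoc s t (f i)
          ; *ₗ-zeroʳ = λ s i → *ₗ-zeroʳ s
          ; *ₗ-distribˡ = λ s f g i → *ₗ-distribˡ s (f i) (g i)
          }
        }
      ; -ᴹ‿cong = λ e i → -ᴹ‿cong (e i)
      ; -ᴹ‿inverse = (λ f i → -ᴹ‿inverseˡ (f i)) , (λ f i → -ᴹ‿inverseʳ (f i))
      }
    }
    where open LeftModule M

  module _ {m ℓm : Level} (M : LeftModule R m ℓm) where

    open LeftModule M
    private
      module R = Ring R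
      module RP = RingProperties R
      module GP = AbelianGroupProperties +ᴹ-abelianGroup

    record Submodule p : Set (r ⊔ m ⊔ ℓm ⊔ lsuc p) where
      infix 4 _∈
      field
        _∈   : Pred Carrierᴹ p
        resp : ∀ {x y} → x ≈ᴹ y → x ∈ → y ∈
        0∈   : 0ᴹ ∈
        +-∈  : ∀ {x y} → x ∈ → y ∈ → (x +ᴹ y) ∈
        *-∈  : ∀ s {x} → x ∈ → (s *ₗ x) ∈

    -1*ₗ : ∀ x → (R.- R.1#) *ₗ x ≈ᴹ -ᴹ x
    -1*ₗ x = GP.inverseˡ-unique _ _ (begin
      (R.- R.1#) *ₗ x +ᴹ x            ≈⟨ +ᴹ-congˡ (*ₗ-identityˡ x) ⟨
      (R.- R.1#) *ₗ x +ᴹ R.1# *ₗ x    ≈⟨ *ₗ-distribʳ x (R.- R.1#) R.1# ⟨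
      (R.- R.1# R.+ R.1#) *ₗ x        ≈⟨ *ₗ-congʳ (R.-‿inverseˡ R.1#) ⟩
      R.0# *ₗ x                       ≈⟨ *ₗ-zeroˡ x ⟩
      0ᴹ                              ∎)
      where open SetoidReasoning ≈ᴹ-setoid

    neg-∈ : ∀ {p} (N : Submodule p) → let open Submodule N in ∀ {x} → x ∈ → (-ᴹ x) ∈
    neg-∈ N x∈ = resp (-1*ₗ _) (*-∈ (R.- R.1#) x∈)
      where open Submodule N

    submodule : ∀ {p} → Submodule p → LeftModule R (m ⊔ p) ℓm
    submodule {p} N = record
      { isLeftModule = LeftModuleMono.isLeftModule mono R.isRing isLeftModule }
      where
      open Submodule N
      raw : RawLeftModule R.Carrier (m ⊔ p) ℓm
      raw = record
        { Carrierᴹ = Σ Carrierᴹ _∈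
        ; _≈ᴹ_ = λ x y → proj₁ x ≈ᴹ proj₁ y
        ; _+ᴹ_ = λ x y → proj₁ x +ᴹ proj₁ y , +-∈ (proj₂ x) (proj₂ y)
        ; _*ₗ_ = λ s x → s *ₗ proj₁ x , *-∈ s (proj₂ x)
        ; 0ᴹ   = 0ᴹ , 0∈
        ; -ᴹ_  = λ x → -ᴹ proj₁ x , neg-∈ N (proj₂ x)
        }
      mono : IsLeftModuleMonomorphism raw rawLeftModule proj₁
      mono = record
        { isLeftModuleHomomorphism = record
          { +ᴹ-isGroupHomomorphism = record
            { isMonoidHomomorphism = record
              { isMagmaHomomorphism = record
                { isRelHomomorphism = record { cong = id }
                ; homo = λ _ _ → ≈ᴹ-refl
                }
              ; ε-homo = ≈ᴹ-refl
              }
            ; ⁻¹-homo = λ _ → ≈ᴹ-refl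
            }
          ; *ₗ-homo = λ _ _ → ≈ᴹ-refl
          }
        ; injective = id
        }

    -- N / P, with x ~ y when x - y lies in P.
    quotient : ∀ {p q} (N : Submodule p) (P : Submodule q) →
               Submodule._∈ P ⊆ Submodule._∈ N → LeftModule R (m ⊔ p) q
    quotient N P _ = record
      { Carrierᴹ = N.Carrierᴹ
      ; _≈ᴹ_ = _~_
      ; _+ᴹ_ = N._+ᴹ_
      ; _*ₗ_ = N._*ₗ_
      ; 0ᴹ   = N.0ᴹ
      ; -ᴹ_  = N.-ᴹ_
      ; isLeftModule = record
        { isLeftSemimodule = record
          { +ᴹ-isCommutativeMonoid = record
            { isMonoid = record
              { isSemigroup = record
                { isMagma = record
                  { isEquivalence = record
                    { refl  = λ {x} → coarsen {x} {x} ≈ᴹ-refl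
                    ; sym   = λ {x} {y} e → resp (GP.⁻¹-anti-homo‿- _ _) (neg-∈ P e)
                    ; trans = λ {x} {y} {z} e f →
                        resp (telescope (proj₁ x) (proj₁ y) (proj₁ z)) (+-∈ e f)
                    }
                  ; ∙-cong = λ {x} {y} {u} {v} e f →
                      resp (sub-+ (proj₁ x) (proj₁ y) (proj₁ u) (proj₁ v)) (+-∈ e f)
                  }
                ; assoc = λ x y z → coarsen {(x N.+ᴹ y) N.+ᴹ z} {x N.+ᴹ (y N.+ᴹ z)} (N.+ᴹ-assoc x y z)
                }
              ; identity = (λ x → coarsen {N.0ᴹ N.+ᴹ x} {x} (N.+ᴹ-identityˡ x))
                         , (λ x → coarsen {x N.+ᴹ N.0ᴹ} {x} (N.+ᴹ-identityʳ x))
              }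
            ; comm = λ x y → coarsen {x N.+ᴹ y} {y N.+ᴹ x} (N.+ᴹ-comm x y)
            }
          ; isPreleftSemimodule = record
            { *ₗ-cong = λ {s} {t} {x} {y} e f →
                resp (sub-* e (proj₁ x) (proj₁ y)) (*-∈ s f)
            ; *ₗ-zeroˡ = λ x → coarsen {R.0# N.*ₗ x} {N.0ᴹ} (N.*ₗ-zeroˡ x)
            ; *ₗ-distribʳ = λ x s t →
                coarsen {(s R.+ t) N.*ₗ x} {s N.*ₗ x N.+ᴹ t N.*ₗ x} (N.*ₗ-distribʳ x s t)
            ; *ₗ-identityˡ = λ x → coarsen {R.1# N.*ₗ x} {x} (N.*ₗ-identityˡ x)
            ; *ₗ-assoc = λ s t x →
                coarsen {(s R.* t) N.*ₗ x} {s N.*ₗ (t N.*ₗ x)} (N.*ₗ-assoc s t x)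
            ; *ₗ-zeroʳ = λ s → coarsen {s N.*ₗ N.0ᴹ} {N.0ᴹ} (N.*ₗ-zeroʳ s)
            ; *ₗ-distribˡ = λ s x y →
                coarsen {s N.*ₗ (x N.+ᴹ y)} {s N.*ₗ x N.+ᴹ s N.*ₗ y} (N.*ₗ-distribˡ s x y)
            }
          }
        ; -ᴹ‿cong = λ {x} {y} e → resp (sub-neg (proj₁ x) (proj₁ y)) (neg-∈ P e)
        ; -ᴹ‿inverse = (λ x → coarsen {(N.-ᴹ x) N.+ᴹ x} {N.0ᴹ} (N.-ᴹ‿inverseˡ x))
                     , (λ x → coarsen {x N.+ᴹ (N.-ᴹ x)} {N.0ᴹ} (N.-ᴹ‿inverseʳ x))
        }
      }
      where
      open Submodule P
      open SetoidReasoning ≈ᴹ-setoid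
      module N = LeftModule (submodule N)
      module SG = CommutativeSemigroupProperties
        (CommutativeMonoid.commutativeSemigroup +ᴹ-commutativeMonoid)

      _~_ : Rel N.Carrierᴹ _
      x ~ y = (proj₁ x +ᴹ -ᴹ proj₁ y) ∈

      coarsen : ∀ {x y} → x N.≈ᴹ y → x ~ y
      coarsen e = resp (≈ᴹ-sym (GP.x≈y⇒x∙y⁻¹≈ε e)) 0∈

      telescope : ∀ x y z → (x +ᴹ -ᴹ y) +ᴹ (y +ᴹ -ᴹ z) ≈ᴹ x +ᴹ -ᴹ z
      telescope x y z = begin
        (x +ᴹ -ᴹ y) +ᴹ (y +ᴹ -ᴹ z)   ≈⟨ +ᴹ-assoc _ _ _ ⟩
        x +ᴹ (-ᴹ y +ᴹ (y +ᴹ -ᴹ z))   ≈⟨ +ᴹ-congˡ (+ᴹ-assoc _ _ _) ⟨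
        x +ᴹ ((-ᴹ y +ᴹ y) +ᴹ -ᴹ z)   ≈⟨ +ᴹ-congˡ (+ᴹ-congʳ (-ᴹ‿inverseˡ y)) ⟩
        x +ᴹ (0ᴹ +ᴹ -ᴹ z)            ≈⟨ +ᴹ-congˡ (+ᴹ-identityˡ _) ⟩
        x +ᴹ -ᴹ z                    ∎

      sub-+ : ∀ x y u v → (x +ᴹ -ᴹ y) +ᴹ (u +ᴹ -ᴹ v) ≈ᴹ (x +ᴹ u) +ᴹ -ᴹ (y +ᴹ v)
      sub-+ x y u v = ≈ᴹ-trans (SG.interchange x (-ᴹ y) u (-ᴹ v)) (+ᴹ-congˡ (GP.⁻¹-∙-comm y v))

      sub-neg : ∀ x y → -ᴹ (x +ᴹ -ᴹ y) ≈ᴹ -ᴹ x +ᴹ -ᴹ (-ᴹ y)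
      sub-neg x y = ≈ᴹ-sym (GP.⁻¹-∙-comm x (-ᴹ y))

      *ₗ-neg : ∀ s x → s *ₗ (-ᴹ x) ≈ᴹ -ᴹ (s *ₗ x)
      *ₗ-neg s x = GP.inverseˡ-unique _ _ (begin
        s *ₗ (-ᴹ x) +ᴹ s *ₗ x   ≈⟨ *ₗ-distribˡ s (-ᴹ x) x ⟨
        s *ₗ (-ᴹ x +ᴹ x)        ≈⟨ *ₗ-congˡ (-ᴹ‿inverseˡ x) ⟩
        s *ₗ 0ᴹ                 ≈⟨ *ₗ-zeroʳ s ⟩
        0ᴹ                      ∎)

      sub-* : ∀ {s t} → s R.≈ t → ∀ x y → s *ₗ (x +ᴹ -ᴹ y) ≈ᴹ s *ₗ x +ᴹ -ᴹ (t *ₗ y)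
      sub-* {s} {t} e x y = begin
        s *ₗ (x +ᴹ -ᴹ y)          ≈⟨ *ₗ-distribˡ s x (-ᴹ y) ⟩
        s *ₗ x +ᴹ s *ₗ (-ᴹ y)     ≈⟨ +ᴹ-congˡ (*ₗ-neg s y) ⟩
        s *ₗ x +ᴹ -ᴹ (s *ₗ y)     ≈⟨ +ᴹ-congˡ (-ᴹ‿cong (*ₗ-congʳ e)) ⟩
        s *ₗ x +ᴹ -ᴹ (t *ₗ y)     ∎

  infixr 7 _∩_
  _∩_ : ∀ {m ℓm p q} {M : LeftModule R m ℓm} → Submodule M p → Submodule M q → Submodule M (p ⊔ q)
  N ∩ P = record
    { _∈   = λ x → (x N.∈) × (x P.∈)
    ; resp = λ e (a , b) → N.resp e a , P.resp e b
    ; 0∈   = N.0∈ , P.0∈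
    ; +-∈  = λ (a , b) (a′ , b′) → N.+-∈ a a′ , P.+-∈ b b′
    ; *-∈  = λ s (a , b) → N.*-∈ s a , P.*-∈ s b
    }
    where
    module N = Submodule N
    module P = Submodule P

  ⋂ : ∀ {m ℓm p i} {M : LeftModule R m ℓm} {I : Set i} → (I → Submodule M p) → Submodule M (p ⊔ i)
  ⋂ N = record
    { _∈   = λ x → ∀ i → Submodule._∈ (N i) x
    ; resp = λ e a i → Submodule.resp (N i) e (a i)
    ; 0∈   = λ i → Submodule.0∈ (N i)
    ; +-∈  = λ a b i → Submodule.+-∈ (N i) (a i) (b i)
    ; *-∈  = λ s a i → Submodule.*-∈ (N i) s (a i)
    }

module RestrictionOfScalars
  {r ℓr s ℓs : Level} (R : Ring r ℓr) (S : Ring s ℓs)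
  {f : Ring.Carrier R → Ring.Carrier S}
  (f-hom : IsRingHomomorphism (Ring.rawRing R) (Ring.rawRing S) f)
  where

  open IsRingHomomorphism f-hom

  restrict : ∀ {m ℓm} → LeftModule S m ℓm → LeftModule R m ℓm
  restrict M = record
    { Carrierᴹ = Carrierᴹ
    ; _≈ᴹ_ = _≈ᴹ_
    ; _+ᴹ_ = _+ᴹ_
    ; _*ₗ_ = λ r x → f r *ₗ x
    ; 0ᴹ   = 0ᴹ
    ; -ᴹ_  = -ᴹ_
    ; isLeftModule = record
      { isLeftSemimodule = record
        { +ᴹ-isCommutativeMonoid = +ᴹ-isCommutativeMonoid
        ; isPreleftSemimodule = record
          { *ₗ-cong = λ d e → *ₗ-cong (⟦⟧-cong d) e
          ; *ₗ-zeroˡ = λ x → ≈ᴹ-trans (*ₗ-congʳ 0#-homo) (*ₗ-zeroˡ x)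
          ; *ₗ-distribʳ = λ x a b → ≈ᴹ-trans (*ₗ-congʳ (+-homo a b)) (*ₗ-distribʳ x (f a) (f b))
          ; *ₗ-identityˡ = λ x → ≈ᴹ-trans (*ₗ-congʳ 1#-homo) (*ₗ-identityˡ x)
          ; *ₗ-assoc = λ a b x → ≈ᴹ-trans (*ₗ-congʳ (*-homo a b)) (*ₗ-assoc (f a) (f b) x)
          ; *ₗ-zeroʳ = λ a → *ₗ-zeroʳ (f a)
          ; *ₗ-distribˡ = λ a → *ₗ-distribˡ (f a)
          }
        }
      ; -ᴹ‿cong = -ᴹ‿cong
      ; -ᴹ‿inverse = -ᴹ‿inverse
      }
    }
    where open LeftModule M

  restrictSubmodule : ∀ {m ℓm p} (M : LeftModule S m ℓm) →
                      Submodule M p → Submodule (restrict M) p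
  restrictSubmodule M N = record
    { _∈ = _∈ ; resp = resp ; 0∈ = 0∈ ; +-∈ = +-∈ ; *-∈ = λ r → *-∈ (f r) }
    where open Submodule N

module Ideals {c ℓ : Level} (S : CommutativeRing c ℓ) where

  open CommutativeRing S
  open BigOperator +-commutativeMonoid using (sum; sum-cong-≋; ∑-distrib-+; sum-replicate-zero)
  open SemiringSum semiring using (*-distribˡ-sum)

  Ideal : ∀ p → Set (c ⊔ ℓ ⊔ lsuc p)
  Ideal = Submodule (TensorUnit.leftModule {R = ring})

  ⟨_⟩ : ∀ {n} → Vector Carrier n → Ideal (c ⊔ ℓ)
  ⟨_⟩ {n} g = record
    { _∈   = λ f → ∃ λ (a : Vector Carrier n) → f ≈ combination a
    ; resp = λ e (a , eq) → a , trans (sym e) eq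
    ; 0∈   = (λ _ → 0#)
           , sym (trans (sum-cong-≋ (λ i → zeroˡ (g i))) (sum-replicate-zero n))
    ; +-∈  = λ (a , eq) (b , eq′) → (λ i → a i + b i)
           , trans (+-cong eq eq′)
               (trans (sym (∑-distrib-+ (λ i → a i * g i) (λ i → b i * g i)))
                 (sum-cong-≋ (λ i → sym (distribʳ (g i) (a i) (b i)))))
    ; *-∈  = λ s (a , eq) → (λ i → s * a i)
           , trans (*-congˡ eq) (trans (*-distribˡ-sum s (λ i → a i * g i))
               (sum-cong-≋ (λ i → sym (*-assoc s (a i) (g i)))))
    }
    where
    combination : Vector Carrier n → Carrier
    combination a = sum (λ i → a i * g i)

------------------------------------------------------------------------
-- Simple graphs

-- adj? makes the edge set a finite list, so that Q can be a product over it.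
record SimpleGraph (n : ℕ) : Set₁ where
  field
    Adj    : Rel (Fin n) 0ℓ
    adj?   : Decidable Adj
    symm   : Symmetric Adj
    irrefl : Irreflexive _≡_ Adj

complement : ∀ {n} → SimpleGraph n → SimpleGraph n
complement G = record
  { Adj    = λ u v → u ≢ v × ¬ Adj u v
  ; adj?   = λ u v → ¬? (u ≟ v) ×-dec ¬? (adj? u v)
  ; symm   = λ (u≢v , ¬uv) → (λ v≡u → u≢v (≡.sym v≡u)) , (λ vu → ¬uv (symm vu))
  ; irrefl = λ u≡v (u≢v , _) → u≢v u≡v
  }
  where open SimpleGraph G

-- Each edge {u,v} is listed once, as (u , v) with u < v.
edges : ∀ {n} → SimpleGraph n → List (Fin n × Fin n)
edges {n} G = List.filter (λ (u , v) → (u <? v) ×-dec adj? u v)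
                          (List.cartesianProduct (List.allFin n) (List.allFin n))
  where open SimpleGraph G

------------------------------------------------------------------------
-- Logarithmic forms and cover ideals

module Arrangements {c ℓ : Level} (K : CommutativeRing c ℓ) (n : ℕ) where

  private module K = CommutativeRing K

  S : CommutativeRing c ℓ
  S = Polynomials K n

  open CommutativeRing S hiding (zero)
  open BigOperator +-commutativeMonoid using (sum)
  open BigOperator *-commutativeMonoid using (sum-remove) renaming (sum to product)
  open Fractions S using (fractionRing; ι; ι-isRingHomomorphism)
  open Subrings S using (Subring; Generated; generatedSubring)
  open Ideals S

  C : K.Carrier → Carrier
  C = const K n

  x : Vector Carrier n
  x = var K

  private
    module SR = SetoidReasoning setoid
    module RP = RingProperties ring
    module SG = CommutativeSemigroupProperties +-commutativeSemigroup
    module SM = CommutativeSemigroupProperties *-commutativeSemigroup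
    module Frac = CommutativeRing fractionRing
    module ι = IsRingHomomorphism ι-isRingHomomorphism

  S-module : LeftModule ring c ℓ
  S-module = TensorUnit.leftModule

  Frac-module : LeftModule ring (c ⊔ ℓ) ℓ
  Frac-module = RestrictionOfScalars.restrict ring Frac.ring ι-isRingHomomorphism
                  (TensorUnit.leftModule {R = Frac.ring})

  -- The form with coordinates ω is Σᵢ ωᵢ dxᵢ.
  Ω¹V : LeftModule ring c ℓ
  Ω¹V = power S-module (Fin n)

  -- The basis of Ω²V consists of the dxᵢ ∧ dxⱼ with i < j.
  Ω²V : LeftModule ring c ℓ
  Ω²V = power S-module (∃₂ λ (i j : Fin n) → i < j)

  rationalForms : LeftModule ring (c ⊔ ℓ) ℓ
  rationalForms = power Frac-module (Fin n)

  module Ω¹V = LeftModule Ω¹V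
  module Ω²V = LeftModule Ω²V
  module Rat = LeftModule rationalForms

  infixl 7 _∧_
  _∧_ : Ω¹V.Carrierᴹ → Ω¹V.Carrierᴹ → Ω²V.Carrierᴹ
  (ω ∧ η) (i , j , _) = ω i * η j - ω j * η i

  ∧-distribʳ-+ : ∀ θ ω η → (ω Ω¹V.+ᴹ η) ∧ θ Ω²V.≈ᴹ (ω ∧ θ) Ω²V.+ᴹ (η ∧ θ)
  ∧-distribʳ-+ θ ω η (i , j , _) = SR.begin
    (ω i + η i) * θ j - (ω j + η j) * θ i
      SR.≈⟨ +-cong (distribʳ _ _ _) (-‿cong (distribʳ _ _ _)) ⟩
    (ω i * θ j + η i * θ j) - (ω j * θ i + η j * θ i)
      SR.≈⟨ +-congˡ (RP.-‿+-comm _ _) ⟨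
    (ω i * θ j + η i * θ j) + (- (ω j * θ i) + - (η j * θ i))
      SR.≈⟨ SG.interchange _ _ _ _ ⟩
    (ω i * θ j - ω j * θ i) + (η i * θ j - η j * θ i) SR.∎

  ∧-*ₗ : ∀ s ω θ → (s Ω¹V.*ₗ ω) ∧ θ Ω²V.≈ᴹ s Ω²V.*ₗ (ω ∧ θ)
  ∧-*ₗ s ω θ (i , j , _) = SR.begin
    (s * ω i) * θ j - (s * ω j) * θ i   SR.≈⟨ +-cong (*-assoc _ _ _) (-‿cong (*-assoc _ _ _)) ⟩
    s * (ω i * θ j) - s * (ω j * θ i)   SR.≈⟨ RP.x[y-z]≈xy-xz _ _ _ ⟨
    s * (ω i * θ j - ω j * θ i)         SR.∎

  0-∧ : ∀ θ → Ω¹V.0ᴹ ∧ θ Ω²V.≈ᴹ Ω²V.0ᴹ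
  0-∧ θ (i , j , _) = trans (+-cong (zeroˡ _) (-‿cong (zeroˡ _))) (-‿inverseʳ 0#)

  -- The coefficient vector of a linear form on Kⁿ.
  LinearForm : Set c
  LinearForm = Vector K.Carrier n

  poly : LinearForm → Carrier
  poly α = sum (λ i → C (α i) * x i)

  d : LinearForm → Ω¹V.Carrierᴹ
  d α i = C (α i)

  -- A finite set of hyperplanes, given by one defining form αH for each
  -- hyperplane H.
  Arrangement : Set c
  Arrangement = List LinearForm

  Q : Arrangement → Carrier
  Q 𝒜 = List.foldr _*_ 1# (List.map poly 𝒜)

  -- ω = η / Q, i.e. ω lies in (1/Q) Ω¹V and η is the polynomial form Q ω.
  HasNumerator : Arrangement → Rat.Carrierᴹ → Ω¹V.Carrierᴹ → Set ℓ
  HasNumerator 𝒜 ω η = Q 𝒜 Rat.*ₗ ω Rat.≈ᴹ ι ∘ η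

  private
    module FracSM = CommutativeSemigroupProperties Frac.*-commutativeSemigroup

    num-resp : ∀ 𝒜 ω ω′ η → ω Rat.≈ᴹ ω′ → HasNumerator 𝒜 ω η → HasNumerator 𝒜 ω′ η
    num-resp 𝒜 ω ω′ η e num i = Frac.trans (Frac.*-congˡ {ι (Q 𝒜)} (Frac.sym (e i))) (num i)

    num-0 : ∀ 𝒜 → HasNumerator 𝒜 Rat.0ᴹ Ω¹V.0ᴹ
    num-0 𝒜 i = Frac.zeroʳ (ι (Q 𝒜))

    num-+ : ∀ 𝒜 ω ω′ η η′ → HasNumerator 𝒜 ω η → HasNumerator 𝒜 ω′ η′ →
            HasNumerator 𝒜 (ω Rat.+ᴹ ω′) (η Ω¹V.+ᴹ η′)
    num-+ 𝒜 ω ω′ η η′ num num′ i = Frac.trans (Frac.distribˡ (ι (Q 𝒜)) (ω i) (ω′ i))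
      (Frac.trans (Frac.+-cong (num i) (num′ i)) (Frac.sym (ι.+-homo (η i) (η′ i))))

    num-* : ∀ 𝒜 s ω η → HasNumerator 𝒜 ω η → HasNumerator 𝒜 (s Rat.*ₗ ω) (s Ω¹V.*ₗ η)
    num-* 𝒜 s ω η num i = Frac.trans (FracSM.x∙yz≈y∙xz (ι (Q 𝒜)) (ι s) (ω i))
      (Frac.trans (Frac.*-congˡ {ι s} (num i)) (Frac.sym (ι.*-homo s (η i))))

  -- η ∧ dα ∈ α Ω²V
  WedgeDivides : Ω¹V.Carrierᴹ → LinearForm → Set (c ⊔ ℓ)
  WedgeDivides η α = ∃[ θ ] η ∧ d α Ω²V.≈ᴹ poly α Ω²V.*ₗ θ

  Ω¹ : Arrangement → Submodule rationalForms (c ⊔ ℓ)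
  Ω¹ 𝒜 = record
    { _∈   = λ ω → ∃[ η ] HasNumerator 𝒜 ω η × All (WedgeDivides η) 𝒜
    ; resp = λ {ω} {ω′} e (η , num , div) → η , num-resp 𝒜 ω ω′ η e num , div
    ; 0∈   = Ω¹V.0ᴹ , num-0 𝒜 , All.universal 0-divides 𝒜
    ; +-∈  = λ {ω} {ω′} (η , num , div) (η′ , num′ , div′) →
        η Ω¹V.+ᴹ η′
      , num-+ 𝒜 ω ω′ η η′ num num′
      , All.zipWith (λ {α} (p , q) → +-divides {η} {η′} α p q) (div , div′)
    ; *-∈  = λ s {ω} (η , num , div) →
        s Ω¹V.*ₗ η
      , num-* 𝒜 s ω η num
      , All.map (λ {α} → *-divides s {η} α) div
    }
    where
    0-divides : ∀ α → WedgeDivides Ω¹V.0ᴹ α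
    0-divides α = Ω²V.0ᴹ , Ω²V.≈ᴹ-trans (0-∧ (d α)) (Ω²V.≈ᴹ-sym (Ω²V.*ₗ-zeroʳ (poly α)))

    +-divides : ∀ {η η′} α → WedgeDivides η α → WedgeDivides η′ α → WedgeDivides (η Ω¹V.+ᴹ η′) α
    +-divides {η} {η′} α (θ , eq) (θ′ , eq′) = θ Ω²V.+ᴹ θ′
      , Ω²V.≈ᴹ-trans (∧-distribʳ-+ (d α) η η′) (Ω²V.≈ᴹ-trans (Ω²V.+ᴹ-cong eq eq′)
          (Ω²V.≈ᴹ-sym (Ω²V.*ₗ-distribˡ (poly α) θ θ′)))

    *-divides : ∀ s {η} α → WedgeDivides η α → WedgeDivides (s Ω¹V.*ₗ η) α
    *-divides s {η} α (θ , eq) = s Ω²V.*ₗ θ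
      , Ω²V.≈ᴹ-trans (∧-*ₗ s η (d α)) (Ω²V.≈ᴹ-trans (Ω²V.*ₗ-congˡ eq)
          (λ p → SM.x∙yz≈y∙xz s (poly α) (θ p)))

  -- R = K[xᵢ - xⱼ | i < j], the subring generated by K and the differences.
  data RGenerator : Pred Carrier c where
    scalar     : ∀ a → RGenerator (C a)
    difference : ∀ {i j} → i < j → RGenerator (x i - x j)

  R-subring : Subring (c ⊔ ℓ)
  R-subring = generatedSubring RGenerator

  R : CommutativeRing (c ⊔ ℓ) ℓ
  R = Subring.commutativeRing R-subring

  open RestrictionOfScalars (CommutativeRing.ring R) ring (Subring.inclusion R-subring) public
    using () renaming (restrict to asR-module; restrictSubmodule to asR-submodule)

  -- ⊕ᵢ (1/Q) R dxᵢ, as an R-module of rational forms.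
  R-forms : Arrangement → Submodule (asR-module rationalForms) (c ⊔ ℓ)
  R-forms 𝒜 = record
    { _∈   = λ ω → ∃[ η ] HasNumerator 𝒜 ω η × (∀ i → η i ∈)
    ; resp = λ {ω} {ω′} e (η , num , η∈) → η , num-resp 𝒜 ω ω′ η e num , η∈
    ; 0∈   = Ω¹V.0ᴹ , num-0 𝒜 , (λ _ → 0∈)
    ; +-∈  = λ {ω} {ω′} (η , num , η∈) (η′ , num′ , η′∈) →
        η Ω¹V.+ᴹ η′ , num-+ 𝒜 ω ω′ η η′ num num′ , (λ i → +-∈ (η∈ i) (η′∈ i))
    ; *-∈  = λ (s , s∈) {ω} (η , num , η∈) →
        s Ω¹V.*ₗ η , num-* 𝒜 s ω η num , (λ i → *-∈ s∈ (η∈ i))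
    }
    where open Subring R-subring

  Ω¹R : Arrangement → LeftModule (CommutativeRing.ring R) (c ⊔ ℓ) ℓ
  Ω¹R 𝒜 = submodule (asR-module rationalForms)
    (asR-submodule rationalForms (Ω¹ 𝒜) ∩ R-forms 𝒜)

  basisForm : Fin n → LinearForm
  basisForm u i = if does (u ≟ i) then K.1# else K.0#

  -- The form x_u - x_v for each edge {u,v}.
  graphicArrangement : SimpleGraph n → Arrangement
  graphicArrangement G =
    List.map (λ (u , v) i → basisForm u i K.- basisForm v i) (edges G)

  coverIdeal : SimpleGraph n → Ideal (c ⊔ ℓ)
  coverIdeal Γ = ⋂ {I = ∃₂ Adj} (λ (u , v , _) → ⟨ x u Vector.∷ x v Vector.∷ Vector.[] ⟩)
    where open SimpleGraph Γ

  productIdeal : Ideal (c ⊔ ℓ)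
  productIdeal = ⟨ product x Vector.∷ Vector.[] ⟩

  productIdeal⊆coverIdeal : ∀ Γ → Submodule._∈ productIdeal ⊆ Submodule._∈ (coverIdeal Γ)
  productIdeal⊆coverIdeal Γ (a , eq) (u , v , _) =
    resp (sym eq) (+-∈ (*-∈ (a zero) (product∈ x u)) 0∈)
    where
    open Submodule ⟨ x u Vector.∷ x v Vector.∷ Vector.[] ⟩
    product∈ : ∀ {k} (y : Vector Carrier k) (w : Fin k) →
               Submodule._∈ ⟨ y w Vector.∷ x v Vector.∷ Vector.[] ⟩ (product y)
    product∈ {suc k} y w = (product (Vector.removeAt y w) Vector.∷ 0# Vector.∷ Vector.[])
      , trans (sum-remove {i = w} y) (trans (*-comm _ _)
          (trans (sym (+-identityʳ _)) (+-congˡ (sym (trans (+-identityʳ _) (zeroˡ _))))))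

  -- J(Γ) / (x₁⋯xₙ)
  J/product : SimpleGraph n → LeftModule ring (c ⊔ ℓ) (c ⊔ ℓ)
  J/product Γ = quotient S-module (coverIdeal Γ) productIdeal (productIdeal⊆coverIdeal Γ)

{-# OPTIONS --safe #-}
module Submission where

-- Since S / (xᵢ) ≅ R by xⱼ ↦ xⱼ - xᵢ, an element f of S has reductions rᵢ in R,
-- and they determine f modulo x₁⋯xₙ. Put Pᵢ = ∏_{j ≠ i} (xⱼ - xᵢ) and let f
-- correspond to the form Σᵢ (rᵢ / Pᵢ) dxᵢ. Then f lies in (xᵤ , xᵥ) iff xᵤ - xᵥ
-- divides rᵤ, so that f lies in J(Gᶜ) iff the poles of the form are along the
-- edges of G; and the condition rᵤ ≡ rᵥ modulo xᵤ - xᵥ says that the residues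
-- along the edge {u,v} cancel. Conversely, values rᵢ congruent in this way for
-- all pairs are interpolated by Newton's divided differences, which exist
-- because each xᵤ - xᵥ is regular modulo every other difference.

open import Defs
open import Algebra.Apartness.Bundles using (HeytingField; HeytingCommutativeRing)
open import Algebra.Bundles using (CommutativeRing; RawRing)
open import Algebra.Module.Bundles using (RawLeftModule)
open import Algebra.Module.Morphism.Structures using (IsLeftModuleIsomorphism)
open import Algebra.Morphism.Structures using (IsRingHomomorphism)
import Algebra.Morphism.Construct.Composition as Composition
import Algebra.Morphism.Construct.Identity as Identity
import Algebra.Properties.AbelianGroup as AbelianGroupProperties
import Algebra.Properties.CommutativeMonoid.Sum as BigOperator
import Algebra.Properties.CommutativeSemigroup as CommutativeSemigroupProperties
import Algebra.Properties.Ring as RingProperties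
import Algebra.Properties.Semiring.Divisibility as SemiringDivisibility
import Algebra.Properties.Semiring.Mult as Multiples
import Algebra.Solver.Ring as RingSolver
open import Algebra.Solver.Ring.AlmostCommutativeRing using (fromCommutativeRing; _-Raw-AlmostCommutative⟶_)
open import Data.Fin.Base using (Fin; zero; suc; _<_)
open import Data.Fin.Properties as Fin using (_≟_; suc-injective)
open import Data.List.Base as List using (List; []; _∷_)
open import Data.List.Relation.Unary.All as All using (All; []; _∷_)
import Data.List.Relation.Unary.All.Properties as All
open import Data.List.Relation.Unary.AllPairs as AllPairs using (AllPairs; []; _∷_)
import Data.List.Relation.Unary.AllPairs.Properties as AllPairs
open import Data.List.Relation.Unary.Any using (here; there)
open import Data.List.Membership.Propositional using (_∈_)
open import Data.List.Membership.Propositional.Properties using (∈-map⁺; ∈-filter⁺; ∈-cartesianProduct⁺; ∈-allFin)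
open import Data.List.Relation.Unary.Unique.Propositional using (Unique)
import Data.List.Relation.Unary.Unique.Propositional.Properties as Unique
open import Data.Maybe.Base using (Maybe; just; nothing)
open import Data.Nat.Base as ℕ using (ℕ; zero; suc)
import Data.Nat.Properties as ℕ
open import Data.Product.Base using (∃; _×_; _,_; proj₁; proj₂)
open import Data.Vec.Functional as Vector using (Vector; updateAt)
open import Data.Vec.Functional.Properties using (updateAt-updates; updateAt-minimal)
open import Function.Base using (_∘_; id)
open import Level using (Level; _⊔_) renaming (suc to lsuc)
open import Relation.Binary.Definitions using (tri<; tri≈; tri>)
open import Relation.Binary.PropositionalEquality.Core as ≡ using (_≡_; _≢_)
import Relation.Binary.Reasoning.Setoid as SetoidReasoning
open import Relation.Nullary.Decidable.Core using (yes; no; _×-dec_)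
open import Relation.Nullary.Negation.Core using (¬_; contradiction)
open import Relation.Unary using (Decidable)

-- Over a Heyting field, `S` comes with no zero test and no factorization algorithm, so degrees and
-- greatest common divisors are not at hand. Regularity modulo an element replaces them, and its
-- basic instances come from substitution: setting `x k` to `x l` kills `x k - x l`, setting `x k`
-- to 0 kills `x k`, and any other difference of variables becomes a difference of distinct
-- variables or a variable up to sign, which is a nonzerodivisor. All comparisons go through the
-- equation `P i * η i ≈ Δ * r i`, where `Δ` is Q and `η` is the numerator of the form. A difference
-- at a nonedge divides only the left factor `P i`, so it must divide `r i`; one at an edge away
-- from `i` divides only `Δ`, so it must divide `η i`. A form is turned into an element of the ideal
-- by solving for `r`, an element of the ideal into a form by solving for `η`.

infixl 10 _[_≔_]
_[_≔_] : ∀ {a} {A : Set a} {n} → Vector A n → Fin n → A → Vector A n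
g [ i ≔ a ] = updateAt g i (λ _ → a)

-- The coefficient (a , b) stands for the integer a - b, which makes
-- cancellation visible to the solver.
module IntegralSolver {c ℓ : Level} (A : CommutativeRing c ℓ) where

  open CommutativeRing A hiding (zero)
  open Multiples semiring using (×-homo-+; ×1-homo-*; ×-homo-1) renaming (_×_ to _·_)
  open SetoidReasoning setoid
  private
    module RP = RingProperties ring
    module GP = AbelianGroupProperties +-abelianGroup
    module SG = CommutativeSemigroupProperties +-commutativeSemigroup

  private
    differences : RawRing _ _
    differences = record
      { Carrier = ℕ × ℕ
      ; _≈_ = _≡_
      ; _+_ = λ (a , b) (d , e) → a ℕ.+ d , b ℕ.+ e
      ; _*_ = λ (a , b) (d , e) → a ℕ.* d ℕ.+ b ℕ.* e , a ℕ.* e ℕ.+ b ℕ.* d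
      ; -_  = λ (a , b) → b , a
      ; 0#  = 0 , 0
      ; 1#  = 1 , 0
      }

    ⟦_⟧ : ℕ × ℕ → Carrier
    ⟦ a , b ⟧ = a · 1# - b · 1#

    sub-+ : ∀ a b d e → (a + d) - (b + e) ≈ (a - b) + (d - e)
    sub-+ a b d e = trans (+-congˡ (sym (GP.⁻¹-∙-comm b e))) (SG.interchange a d (- b) (- e))

    sub-* : ∀ a b d e → (a * d + b * e) - (a * e + b * d) ≈ (a - b) * (d - e)
    sub-* a b d e = begin
      (a * d + b * e) - (a * e + b * d)       ≈⟨ sub-+ (a * d) (a * e) (b * e) (b * d) ⟩
      (a * d - a * e) + (b * e - b * d)       ≈⟨ +-cong (sym (RP.x[y-z]≈xy-xz a d e)) (sym (GP.⁻¹-anti-homo‿- (b * d) (b * e))) ⟩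
      a * (d - e) - (b * d - b * e)           ≈⟨ +-congˡ (-‿cong (sym (RP.x[y-z]≈xy-xz b d e))) ⟩
      a * (d - e) - b * (d - e)               ≈⟨ RP.[y-z]x≈yx-zx (d - e) a b ⟨
      (a - b) * (d - e)                       ∎

    +-homo : ∀ p q → ⟦ RawRing._+_ differences p q ⟧ ≈ ⟦ p ⟧ + ⟦ q ⟧
    +-homo (a , b) (d , e) = trans
      (+-cong (×-homo-+ 1# a d) (-‿cong (×-homo-+ 1# b e)))
      (sub-+ _ _ _ _)

    multiply : ∀ a b d e → (a ℕ.* d ℕ.+ b ℕ.* e) · 1# ≈ (a · 1#) * (d · 1#) + (b · 1#) * (e · 1#)
    multiply a b d e = trans (×-homo-+ 1# (a ℕ.* d) (b ℕ.* e)) (+-cong (×1-homo-* a d) (×1-homo-* b e))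

    *-homo : ∀ p q → ⟦ RawRing._*_ differences p q ⟧ ≈ ⟦ p ⟧ * ⟦ q ⟧
    *-homo (a , b) (d , e) = trans
      (+-cong (multiply a b d e) (-‿cong (multiply a b e d)))
      (sub-* _ _ _ _)

    morphism : differences -Raw-AlmostCommutative⟶ fromCommutativeRing A
    morphism = record
      { ⟦_⟧    = ⟦_⟧
      ; +-homo = +-homo
      ; *-homo = *-homo
      ; -‿homo = λ (a , b) → sym (GP.⁻¹-anti-homo‿- _ _)
      ; 0-homo = -‿inverseʳ 0#
      ; 1-homo = trans (+-cong (×-homo-1 1#) RP.-0#≈0#) (+-identityʳ 1#)
      }

    balance : ∀ a b d e → a + e ≈ d + b → a - b ≈ d - e
    balance a b d e eq = GP.x∙y⁻¹≈ε⇒x≈y _ _ (begin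
      (a - b) - (d - e)   ≈⟨ +-congˡ (GP.⁻¹-anti-homo‿- d e) ⟩
      (a - b) + (e - d)   ≈⟨ sub-+ a b e d ⟨
      (a + e) - (b + d)   ≈⟨ GP.x≈y⇒x∙y⁻¹≈ε (trans eq (+-comm d b)) ⟩
      0#                  ∎)

    -- Coefficients are compared as integers: one normal form may hold (1 , 1) where the other holds
    -- (0 , 0).
    equal? : ∀ p q → Maybe (⟦ p ⟧ ≈ ⟦ q ⟧)
    equal? (a , b) (d , e) with a ℕ.+ e ℕ.≟ d ℕ.+ b
    ... | no _   = nothing
    ... | yes eq = just (balance _ _ _ _ (begin
      a · 1# + e · 1#     ≈⟨ ×-homo-+ 1# a e ⟨
      (a ℕ.+ e) · 1#      ≡⟨ ≡.cong (_· 1#) eq ⟩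
      (d ℕ.+ b) · 1#      ≈⟨ ×-homo-+ 1# d b ⟩
      d · 1# + b · 1#     ∎))

  open RingSolver differences (fromCommutativeRing A) morphism equal? public
    using (solve; _:+_; _:*_; _:-_; :-_; _:=_)

-- Divisibility and elements regular modulo another

module Congruences {c ℓ : Level} (A : CommutativeRing c ℓ) where

  open CommutativeRing A hiding (zero)
  open IntegralSolver A
  open SemiringDivisibility semiring public
    using (_∣_; _∣ʳ_; _,_; _∣0; 0∣x⇒x≈0; ∣ʳ-refl; ∣ʳ-trans; ∣ʳ-respʳ-≈; ∣ʳ-respˡ-≈; x∣ʳy⇒x∣ʳzy)
  open Fractions A using (Regular)
  open BigOperator *-commutativeMonoid using () renaming (sum to product)
  open SetoidReasoning setoid
  private
    module RP = RingProperties ring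
    module GP = AbelianGroupProperties +-abelianGroup

  ∣-+ : ∀ {d a b} → d ∣ a → d ∣ b → d ∣ a + b
  ∣-+ (p , e) (q , f) = p + q , trans (distribʳ _ p q) (+-cong e f)

  ∣-neg : ∀ {d a} → d ∣ a → d ∣ - a
  ∣-neg (p , e) = - p , trans (sym (RP.-‿distribˡ-* p _)) (-‿cong e)

  ∣-minus : ∀ {d a b} → d ∣ a → d ∣ b → d ∣ a - b
  ∣-minus a b = ∣-+ a (∣-neg b)

  neg-∣ : ∀ {d a} → d ∣ a → - d ∣ a
  neg-∣ {d} (p , e) = - p , trans (solve 2 (λ p d → :- p :* :- d := p :* d) refl p d) e

  ∣-*ʳ : ∀ {d a} b → d ∣ a → d ∣ a * b
  ∣-*ʳ b d∣a = ∣ʳ-respʳ-≈ (*-comm b _) (x∣ʳy⇒x∣ʳzy b d∣a)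

  ∣-difference : ∀ {d a b} → a ≈ b → d ∣ a - b
  ∣-difference {d} e = ∣ʳ-respʳ-≈ (sym (GP.x≈y⇒x∙y⁻¹≈ε e)) (d ∣0)

  ∣-transfer : ∀ {d a b} → d ∣ a - b → d ∣ b → d ∣ a
  ∣-transfer {_} {a} {b} a≡b d∣b =
    ∣ʳ-respʳ-≈ (solve 2 (λ a b → (a :- b) :+ b := a) refl a b) (∣-+ a≡b d∣b)

  ∣-*-cong : ∀ {d a b a′ b′} → d ∣ a - a′ → d ∣ b - b′ → d ∣ a * b - a′ * b′
  ∣-*-cong {_} {a} {b} {a′} {b′} p q = ∣ʳ-respʳ-≈
    (solve 4 (λ a b a′ b′ → (a :- a′) :* b :+ a′ :* (b :- b′) := a :* b :- a′ :* b′) refl a b a′ b′)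
    (∣-+ (∣-*ʳ b p) (x∣ʳy⇒x∣ʳzy a′ q))

  ∣-product-cong : ∀ {d m} (f g : Vector Carrier m) →
                   (∀ i → d ∣ f i - g i) → d ∣ product f - product g
  ∣-product-cong {m = zero}  f g e = ∣-difference refl
  ∣-product-cong {m = suc m} f g e =
    ∣-*-cong (e zero) (∣-product-cong (f ∘ suc) (g ∘ suc) (e ∘ suc))

  regular⇒nonzerodivisor : ∀ {h f} → Regular h → h * f ≈ 0# → f ≈ 0#
  regular⇒nonzerodivisor reg e = reg (trans e (sym (zeroʳ _)))

  nonzerodivisor⇒regular : ∀ {h} → (∀ f → h * f ≈ 0# → f ≈ 0#) → Regular h
  nonzerodivisor⇒regular {h} nzd {a} {b} e =
    GP.x∙y⁻¹≈ε⇒x≈y a b (nzd (a - b) (trans (RP.x[y-z]≈xy-xz h a b) (GP.x≈y⇒x∙y⁻¹≈ε e)))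

  Regular-resp : ∀ {h h′} → h ≈ h′ → Regular h → Regular h′
  Regular-resp e reg eq = reg (trans (*-congʳ e) (trans eq (*-congʳ (sym e))))

  Regular-neg : ∀ {h} → Regular h → Regular (- h)
  Regular-neg reg e = reg (trans (sym (neg-neg _ _)) (trans (-‿cong e) (neg-neg _ _)))
    where
    neg-neg : ∀ h f → - (- h * f) ≈ h * f
    neg-neg = solve 2 (λ h f → :- (:- h :* f) := h :* f) refl

  -- Multiplication by `h` is injective on the quotient by `d`; phrased with divisibility, so that
  -- no quotient ring has to be formed.
  RegularMod : Carrier → Carrier → Set (c ⊔ ℓ)
  RegularMod d h = ∀ {f} → d ∣ h * f → d ∣ f

  RegularMod-resp : ∀ {d h h′} → h ≈ h′ → RegularMod d h → RegularMod d h′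
  RegularMod-resp e reg p = reg (∣ʳ-respʳ-≈ (*-congʳ (sym e)) p)

  RegularMod-1 : ∀ {d} → RegularMod d 1#
  RegularMod-1 p = ∣ʳ-respʳ-≈ (*-identityˡ _) p

  RegularMod-* : ∀ {d g h} → RegularMod d g → RegularMod d h → RegularMod d (g * h)
  RegularMod-* rg rh p = rh (rg (∣ʳ-respʳ-≈ (*-assoc _ _ _) p))

  RegularMod-product : ∀ {d m} (g : Vector Carrier m) →
                       (∀ i → RegularMod d (g i)) → RegularMod d (product g)
  RegularMod-product {m = zero}  g reg = RegularMod-1
  RegularMod-product {m = suc m} g reg =
    RegularMod-* (reg zero) (RegularMod-product (g ∘ suc) (reg ∘ suc))

  Regular-product : ∀ {m} (g : Vector Carrier m) → (∀ i → Regular (g i)) → Regular (product g)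
  Regular-product {m = zero}  g reg = Fractions.1-regular A
  Regular-product {m = suc m} g reg =
    Fractions.*-regular A (reg zero) (Regular-product (g ∘ suc) (reg ∘ suc))

  productₗ : List Carrier → Carrier
  productₗ = List.foldr _*_ 1#

  RegularMod-productₗ : ∀ {d hs} → All (RegularMod d) hs → RegularMod d (productₗ hs)
  RegularMod-productₗ []         = RegularMod-1
  RegularMod-productₗ (rh ∷ rhs) = RegularMod-* rh (RegularMod-productₗ rhs)

  Regular-productₗ : ∀ {hs} → All Regular hs → Regular (productₗ hs)
  Regular-productₗ []         = Fractions.1-regular A
  Regular-productₗ (rh ∷ rhs) = Fractions.*-regular A rh (Regular-productₗ rhs)

  product≡productₗ : ∀ {m} (g : Vector Carrier m) → product g ≡ productₗ (List.tabulate g)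
  product≡productₗ {zero}  g = ≡.refl
  product≡productₗ {suc m} g = ≡.cong (g zero *_) (product≡productₗ (g ∘ suc))

  -- For nonzero elements of a factorial domain this says that d and e are coprime.
  Coprime : Carrier → Carrier → Set (c ⊔ ℓ)
  Coprime d e = RegularMod d e × RegularMod e d

  Coprime-sym : ∀ {d e} → Coprime d e → Coprime e d
  Coprime-sym (p , q) = q , p

  Coprime-respˡ : ∀ {d d′ e} → d ≈ d′ → Coprime d e → Coprime d′ e
  Coprime-respˡ eq (p , q) =
    (λ d′∣ → ∣ʳ-respˡ-≈ eq (p (∣ʳ-respˡ-≈ (sym eq) d′∣))) , RegularMod-resp eq q

  Coprime-1ˡ : ∀ {e} → Coprime 1# e
  Coprime-1ˡ = (λ _ → _ , *-identityʳ _) , RegularMod-1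

  ∣⇒∣productₗ : ∀ {d ds} → d ∈ ds → d ∣ productₗ ds
  ∣⇒∣productₗ (here ≡.refl) = ∣-*ʳ _ ∣ʳ-refl
  ∣⇒∣productₗ (there d∈)    = x∣ʳy⇒x∣ʳzy _ (∣⇒∣productₗ d∈)

  -- Write `f` as `q * d`. Every later `e` divides this product and `d` is regular modulo `e`, so
  -- `e` divides `q`, and induction applies to `q`.
  productₗ-∣ : ∀ {ds f} → AllPairs Coprime ds → All (_∣ f) ds → productₗ ds ∣ f
  productₗ-∣ {_} {f} [] [] = f , *-identityʳ f
  productₗ-∣ {d ∷ ds} {f} (cop ∷ cops) ((q , qd≈f) ∷ ds∣f) =
    let r , rds≈q = productₗ-∣ cops (All.zipWith (λ ((_ , reg) , e∣f) →
          reg (∣ʳ-respʳ-≈ (trans (sym qd≈f) (*-comm q d)) e∣f)) (cop , ds∣f))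
    in r , (begin
      r * (d * productₗ ds)   ≈⟨ *-congˡ (*-comm d _) ⟩
      r * (productₗ ds * d)   ≈⟨ *-assoc r _ d ⟨
      r * productₗ ds * d     ≈⟨ *-congʳ rds≈q ⟩
      q * d                   ≈⟨ qd≈f ⟩
      f                       ∎)

  -- The substitute for "`d` is a simple factor": what remains after removing `d` once can be
  -- cancelled modulo `d`.
  productₗ-cofactor : ∀ {d ds} → AllPairs Coprime ds → d ∈ ds →
                      ∃ λ q → productₗ ds ≈ d * q × RegularMod d q
  productₗ-cofactor (cop ∷ cops) (here ≡.refl) = _ , refl , RegularMod-productₗ (All.map proj₁ cop)
  productₗ-cofactor {d} {e ∷ ds} (cop ∷ cops) (there d∈) =
    let q , eq , reg = productₗ-cofactor cops d∈
    in e * q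
     , trans (*-congˡ eq) (solve 3 (λ e d q → e :* (d :* q) := d :* (e :* q)) refl e d q)
     , RegularMod-* (proj₂ (All.lookup cop d∈)) reg

  product-∣ : ∀ {m f} (g : Vector Carrier m) → (∀ {i j} → i ≢ j → Coprime (g i) (g j)) →
              (∀ i → g i ∣ f) → product g ∣ f
  product-∣ {f = f} g cop g∣f = ≡.subst (_∣ f) (≡.sym (product≡productₗ g))
    (productₗ-∣ (AllPairs.tabulate⁺ cop) (All.tabulate⁺ g∣f))

  ∣-product : ∀ {m} (g : Vector Carrier m) i → g i ∣ product g
  ∣-product g zero    = ∣-*ʳ _ ∣ʳ-refl
  ∣-product g (suc i) = x∣ʳy⇒x∣ʳzy (g zero) (∣-product (g ∘ suc) i)

  product-extract : ∀ {m} (g : Vector Carrier m) i →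
                    product g ≈ g i * product (g [ i ≔ 1# ])
  product-extract g zero    = *-congˡ (sym (*-identityˡ _))
  product-extract g (suc i) = trans (*-congˡ (product-extract (g ∘ suc) i))
    (solve 3 (λ a b d → a :* (b :* d) := b :* (a :* d)) refl _ _ _)

  -- Newton interpolation: subtract the value at the first point and divide by
  -- the differences x i - x zero.
  interpolate : ∀ {m} (x r : Vector Carrier m) →
    (∀ {i j k} → i ≢ k → j ≢ k → RegularMod (x i - x j) (x i - x k)) →
    (∀ i j → x i - x j ∣ r i - r j) →
    ∃ λ f → ∀ i → x i ∣ f - r i
  interpolate {zero}  x r reg cong = 0# , λ ()
  interpolate {suc m} x r reg cong = f , congruent
    where
    g : Vector Carrier m
    g i = _∣ʳ_.quotient (cong (suc i) zero)

    g-eq : ∀ i → g i * (x (suc i) - x zero) ≈ r (suc i) - r zero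
    g-eq i = _∣ʳ_.equality (cong (suc i) zero)

    -- It suffices to check this after multiplying by `x (suc i) - x zero`, which is regular modulo
    -- the divisor.
    g-cong : ∀ i j → x (suc i) - x (suc j) ∣ g i - g j
    g-cong i j = reg {suc i} {suc j} {zero} (λ ()) (λ ())
      (∣ʳ-respʳ-≈ identity (∣-minus (cong (suc i) (suc j)) (x∣ʳy⇒x∣ʳzy (g j) ∣ʳ-refl)))
      where
      identity : (r (suc i) - r (suc j)) - g j * (x (suc i) - x (suc j))
                 ≈ (x (suc i) - x zero) * (g i - g j)
      identity = begin
        (r (suc i) - r (suc j)) - g j * (x (suc i) - x (suc j))
          ≈⟨ solve 6 (λ r r′ r₀ a b g → (r :- r′) :- g :* (a :- b) := (r :- r₀) :- (r′ :- r₀) :- g :* (a :- b))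
               refl (r (suc i)) (r (suc j)) (r zero) (x (suc i)) (x (suc j)) (g j) ⟩
        (r (suc i) - r zero) - (r (suc j) - r zero) - g j * (x (suc i) - x (suc j))
          ≈⟨ +-congʳ (+-cong (g-eq i) (-‿cong (g-eq j))) ⟨
        g i * (x (suc i) - x zero) - g j * (x (suc j) - x zero) - g j * (x (suc i) - x (suc j))
          ≈⟨ solve 5 (λ g h a b z → g :* (a :- z) :- h :* (b :- z) :- h :* (a :- b) := (a :- z) :* (g :- h))
               refl (g i) (g j) (x (suc i)) (x (suc j)) (x zero) ⟩
        (x (suc i) - x zero) * (g i - g j) ∎

    rest : ∃ λ q → ∀ i → x (suc i) ∣ q - g i
    rest = interpolate (x ∘ suc) g
      (λ i≢k j≢k → reg (i≢k ∘ suc-injective) (j≢k ∘ suc-injective)) g-cong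

    q f : Carrier
    q = proj₁ rest
    -- Modulo `x (suc i)` the defining equation of `g i` reads
    -- `- x zero * g i ≡ r (suc i) - r zero`, which dictates the sign.
    f = r zero - x zero * q

    congruent : ∀ i → x i ∣ f - r i
    congruent zero    = ∣ʳ-respʳ-≈
      (solve 3 (λ r x q → :- q :* x := r :- x :* q :- r) refl (r zero) (x zero) q)
      (x∣ʳy⇒x∣ʳzy (- q) ∣ʳ-refl)
    congruent (suc i) = ∣ʳ-respʳ-≈ identity
      (∣-minus (x∣ʳy⇒x∣ʳzy (- x zero) (proj₂ rest i)) (x∣ʳy⇒x∣ʳzy (g i) ∣ʳ-refl))
      where
      identity : - x zero * (q - g i) - g i * x (suc i) ≈ f - r (suc i)
      identity = begin
        - x zero * (q - g i) - g i * x (suc i)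
          ≈⟨ solve 5 (λ z x q g r → :- z :* (q :- g) :- g :* x := r :- z :* q :- (g :* (x :- z) :+ r))
               refl (x zero) (x (suc i)) q (g i) (r zero) ⟩
        f - (g i * (x (suc i) - x zero) + r zero)
          ≈⟨ +-congˡ (-‿cong (+-congʳ (g-eq i))) ⟩
        f - ((r (suc i) - r zero) + r zero)
          ≈⟨ solve 3 (λ f r z → f :- ((r :- z) :+ z) := f :- r) refl f (r (suc i)) (r zero) ⟩
        f - r (suc i) ∎

-- Polynomial substitution

module _ {a ℓa b ℓb : Level} (A : CommutativeRing a ℓa) (B : CommutativeRing b ℓb) where

  private
    module A = CommutativeRing A
    module B = CommutativeRing B

  RingHom : (A.Carrier → B.Carrier) → Set _
  RingHom = IsRingHomomorphism A.rawRing B.rawRing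

  ringHom : ∀ {f : A.Carrier → B.Carrier} →
            (∀ {x y} → x A.≈ y → f x B.≈ f y) →
            (∀ x y → f (x A.+ y) B.≈ f x B.+ f y) →
            (∀ x y → f (x A.* y) B.≈ f x B.* f y) →
            f A.1# B.≈ B.1# → RingHom f
  ringHom {f} cong +-homo *-homo 1-homo = record
    { isSemiringHomomorphism = record
      { isNearSemiringHomomorphism = record
        { +-isMonoidHomomorphism = record
          { isMagmaHomomorphism = record
            { isRelHomomorphism = record { cong = cong } ; homo = +-homo }
          ; ε-homo = 0-homo
          }
        ; *-homo = *-homo
        }
      ; 1#-homo = 1-homo
      }
    ; -‿homo = λ x → GP.inverseˡ-unique _ _
        (B.trans (B.sym (+-homo (A.- x) x)) (B.trans (cong (A.-‿inverseˡ x)) 0-homo))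
    }
    where
    module RP = RingProperties B.ring
    module GP = AbelianGroupProperties B.+-abelianGroup
    0-homo : f A.0# B.≈ B.0#
    0-homo = RP.x+x≈x⇒x≈0 _ (B.trans (B.sym (+-homo A.0# A.0#)) (cong (A.+-identityˡ A.0#)))

module Horner {a ℓa b ℓb : Level} (A : CommutativeRing a ℓa) (B : CommutativeRing b ℓb)
  {h : CommutativeRing.Carrier A → CommutativeRing.Carrier B} (hom : RingHom A B h)
  (t : CommutativeRing.Carrier B) where

  private module A = CommutativeRing A
  open CommutativeRing B hiding (zero)
  open IsRingHomomorphism hom
  open Univariate A
  open IntegralSolver B
  open SetoidReasoning setoid

  horner : List A.Carrier → Carrier
  horner []      = 0#
  horner (c ∷ p) = h c + t * horner p

  -- Equal polynomials may be lists of different lengths, so congruence needs trailing zeros to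
  -- evaluate to zero.
  horner-zero : ∀ p → p ≋ [] → horner p ≈ 0#
  horner-zero []      e = refl
  horner-zero (c ∷ p) e = begin
    h c + t * horner p   ≈⟨ +-cong (trans (⟦⟧-cong (at e 0)) 0#-homo)
                                   (*-congˡ (horner-zero p (mk≋ (λ n → at e (suc n))))) ⟩
    0# + t * 0#          ≈⟨ trans (+-identityˡ _) (zeroʳ t) ⟩
    0#                   ∎

  horner-cong : ∀ p q → p ≋ q → horner p ≈ horner q
  horner-cong []      q       e = sym (horner-zero q (≋-sym e))
  horner-cong (c ∷ p) []      e = horner-zero (c ∷ p) e
  horner-cong (c ∷ p) (d ∷ q) e = +-cong (⟦⟧-cong (at e 0))
    (*-congˡ (horner-cong p q (mk≋ (λ n → at e (suc n)))))

  horner-⊕ : ∀ p q → horner (p ⊕ q) ≈ horner p + horner q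
  horner-⊕ []      q       = sym (+-identityˡ _)
  horner-⊕ (c ∷ p) []      = sym (+-identityʳ _)
  horner-⊕ (c ∷ p) (d ∷ q) = begin
    h (c A.+ d) + t * horner (p ⊕ q)            ≈⟨ +-cong (+-homo c d) (*-congˡ (horner-⊕ p q)) ⟩
    (h c + h d) + t * (horner p + horner q)     ≈⟨ solve 5 (λ c d t p q → (c :+ d) :+ t :* (p :+ q) := (c :+ t :* p) :+ (d :+ t :* q))
                                                     refl (h c) (h d) t (horner p) (horner q) ⟩
    (h c + t * horner p) + (h d + t * horner q) ∎

  horner-· : ∀ c p → horner (c · p) ≈ h c * horner p
  horner-· c []      = sym (zeroʳ (h c))
  horner-· c (d ∷ p) = begin
    h (c A.* d) + t * horner (c · p)   ≈⟨ +-cong (*-homo c d) (*-congˡ (horner-· c p)) ⟩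
    h c * h d + t * (h c * horner p)   ≈⟨ solve 4 (λ c d t p → c :* d :+ t :* (c :* p) := c :* (d :+ t :* p))
                                            refl (h c) (h d) t (horner p) ⟩
    h c * (h d + t * horner p)         ∎

  horner-⊛ : ∀ p q → horner (p ⊛ q) ≈ horner p * horner q
  horner-⊛ []      q = sym (zeroˡ _)
  horner-⊛ (c ∷ p) q = begin
    horner (c · q ⊕ (A.0# ∷ (p ⊛ q)))               ≈⟨ horner-⊕ (c · q) (A.0# ∷ (p ⊛ q)) ⟩
    horner (c · q) + (h A.0# + t * horner (p ⊛ q))  ≈⟨ +-cong (horner-· c q) (+-cong 0#-homo (*-congˡ (horner-⊛ p q))) ⟩
    h c * horner q + (0# + t * (horner p * horner q))
      ≈⟨ +-congˡ (+-identityˡ _) ⟩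
    h c * horner q + t * (horner p * horner q)
      ≈⟨ solve 4 (λ c q t p → c :* q :+ t :* (p :* q) := (c :+ t :* p) :* q) refl (h c) (horner q) t (horner p) ⟩
    (h c + t * horner p) * horner q                 ∎

  horner-const : ∀ c → horner (c ∷ []) ≈ h c
  horner-const c = trans (+-congˡ (zeroʳ t)) (+-identityʳ (h c))

  horner-isRingHom : RingHom polynomialRing B horner
  horner-isRingHom = ringHom polynomialRing B (λ {p} {q} → horner-cong p q) horner-⊕ horner-⊛
    (trans (horner-const A.1#) 1#-homo)

module Substitution {k ℓk b ℓb : Level} (K : CommutativeRing k ℓk) (B : CommutativeRing b ℓb)
  {h : CommutativeRing.Carrier K → CommutativeRing.Carrier B} (hom : RingHom K B h) where

  open CommutativeRing B hiding (zero)

  -- Horner's scheme for the next variable takes as a parameter the proof that evaluation of the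
  -- coefficients is a homomorphism, hence the simultaneous definition.
  evaluate : ∀ n → Vector Carrier n → CommutativeRing.Carrier (Polynomials K n) → Carrier
  evaluate-isRingHom : ∀ n (y : Vector Carrier n) → RingHom (Polynomials K n) B (evaluate n y)

  evaluate zero    y = h
  evaluate (suc n) y = Horner.horner (Polynomials K n) B (evaluate-isRingHom n (y ∘ suc)) (y zero)

  evaluate-isRingHom zero    y = hom
  evaluate-isRingHom (suc n) y =
    Horner.horner-isRingHom (Polynomials K n) B (evaluate-isRingHom n (y ∘ suc)) (y zero)

  evaluate-const : ∀ n y c → evaluate n y (const K n c) ≈ h c
  evaluate-const zero    y c = refl
  evaluate-const (suc n) y c = trans
    (Horner.horner-const (Polynomials K n) B (evaluate-isRingHom n (y ∘ suc)) (y zero) (const K n c))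
    (evaluate-const n (y ∘ suc) c)

  evaluate-var : ∀ n y i → evaluate n y (var K i) ≈ y i
  evaluate-var (suc n) y zero = begin
    e 0ₙ + y zero * (e 1ₙ + y zero * 0#)   ≈⟨ +-cong 0#-homo (*-congˡ (trans (+-cong 1#-homo (zeroʳ _)) (+-identityʳ _))) ⟩
    0# + y zero * 1#                       ≈⟨ trans (+-identityˡ _) (*-identityʳ _) ⟩
    y zero                                 ∎
    where
    open SetoidReasoning setoid
    open CommutativeRing (Polynomials K n) using () renaming (0# to 0ₙ; 1# to 1ₙ)
    open IsRingHomomorphism (evaluate-isRingHom n (y ∘ suc))
    e = evaluate n (y ∘ suc)
  evaluate-var (suc n) y (suc i) = trans
    (Horner.horner-const (Polynomials K n) B (evaluate-isRingHom n (y ∘ suc)) (y zero) (var K i))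
    (evaluate-var n (y ∘ suc) i)

-- Constants and variables in polynomial rings

module PolynomialLemmas {c ℓ : Level} (K : CommutativeRing c ℓ) where

  const-isRingHom : ∀ n → RingHom K (Polynomials K n) (const K n)
  const-isRingHom zero    = Identity.isRingHomomorphism _ (CommutativeRing.refl K)
  const-isRingHom (suc n) = ringHom K (Polynomials K (suc n))
    (λ e → ∷-cong (⟦⟧-cong e) ≋-refl)
    (λ x y → ∷-cong (+-homo x y) ≋-refl)
    (λ x y → ∷-cong (trans (*-homo x y) (sym (+-identityʳ _))) ≋-refl)
    (∷-cong 1#-homo ≋-refl)
    where
    open CommutativeRing (Polynomials K n)
    open Univariate (Polynomials K n)
    open IsRingHomomorphism (const-isRingHom n)

  module _ (n : ℕ) where

    open CommutativeRing (Polynomials K n) hiding (zero)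
    open Univariate (Polynomials K n)

    var-zero-⊛ : ∀ p → var K {suc n} zero ⊛ p ≋ 0# ∷ p
    var-zero-⊛ p = ≋-trans
      (⊕-cong (·-zero p refl) (≋-refl {0# ∷ ((1# ∷ []) ⊛ p)}))
      (∷-cong refl (⊛-identityˡ p))

    constant-⊛ : ∀ a p → (a ∷ []) ⊛ p ≋ a · p
    constant-⊛ a p = ≋-trans (⊕-cong (≋-refl {a · p}) (0∷-zero ≋-refl)) (⊕-identityʳ (a · p))

  -- Induction principle for polynomials: a property closed under the ring operations need only be
  -- checked on constants and variables. Coefficients are handled by recursion, through the part of
  -- `P` free of the first variable.
  spanned : ∀ n {p} (P : Subrings.Subring (Polynomials K n) p) → let open Subrings.Subring P in
            (∀ a → (const K n a) ∈) → (∀ (i : Fin n) → (var K i) ∈) → ∀ f → f ∈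
  spanned zero    P c∈ x∈ f = c∈ f
  spanned (suc n) P c∈ x∈ = list∈
    where
    open CommutativeRing (Polynomials K n) hiding (zero)
    open Univariate (Polynomials K n)
    open Subrings.Subring P renaming (neg-∈ to -‿∈)

    constants : Subrings.Subring (Polynomials K n) _
    constants = record
      { _∈ = λ a → (a ∷ []) ∈
      ; resp = λ e → resp (∷-cong e ≋-refl)
      ; 0∈ = resp (≋-sym (0∷-zero ≋-refl)) 0∈
      ; 1∈ = 1∈
      ; +-∈ = +-∈
      ; *-∈ = λ a b → resp (∷-cong (+-identityʳ _) ≋-refl) (*-∈ a b)
      ; neg-∈ = -‿∈
      }

    decompose : ∀ a p → (a ∷ []) ⊕ (var K {suc n} zero ⊛ p) ≋ a ∷ p
    decompose a p = ≋-trans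
      (⊕-cong {a ∷ []} ≋-refl (var-zero-⊛ n p))
      (∷-cong (+-identityʳ a) ≋-refl)

    list∈ : ∀ f → f ∈
    list∈ []      = 0∈
    list∈ (a ∷ p) = resp (decompose a p)
      (+-∈ (spanned n constants c∈ (x∈ ∘ suc) a) (*-∈ (x∈ zero) (list∈ p)))

  -- Multiplication by the first variable shifts the coefficients; any other variable acts on each
  -- coefficient separately, where induction applies.
  var-regular : ∀ n (i : Fin n) → Fractions.Regular (Polynomials K n) (var K i)
  var-regular (suc n) zero {f} {g} e = mk≋ (λ m → trans (sym (shift f m)) (trans (at e (suc m)) (shift g m)))
    where
    open CommutativeRing (Polynomials K n) hiding (zero)
    open Univariate (Polynomials K n)
    shift : ∀ f m → coeff (var K {suc n} zero ⊛ f) (suc m) ≈ coeff f m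
    shift f m = at (var-zero-⊛ n f) (suc m)
  var-regular (suc n) (suc i) {f} {g} e = mk≋ (λ m →
    var-regular n i (trans (sym (scale f m)) (trans (at e m) (scale g m))))
    where
    open CommutativeRing (Polynomials K n) hiding (zero)
    open Univariate (Polynomials K n)
    scale : ∀ f m → coeff ((var K i ∷ []) ⊛ f) m ≈ var K i * coeff f m
    scale f m = trans (at (constant-⊛ n (var K i) f) m) (coeff-· (var K i) f m)

-- Isomorphisms from linear relations

module _ {r m ℓm m′ ℓm′ : Level} {R : Set r}
  {M : RawLeftModule R m ℓm} {N : RawLeftModule R m′ ℓm′} where

  private
    module M = RawLeftModule M
    module N = RawLeftModule N

  -- A relation avoids reasoning about the chosen interpolant, which does not visibly depend
  -- linearly on its data. Linearity of the relation is immediate and passes to the choice by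
  -- `functional`. The field `≈-refl` is there because raw modules carry no laws.
  record LinearBijection p : Set (r ⊔ m ⊔ ℓm ⊔ m′ ⊔ ℓm′ ⊔ lsuc p) where
    infix 4 _~_
    field
      _~_        : M.Carrierᴹ → N.Carrierᴹ → Set p
      total      : ∀ x → ∃ λ y → x ~ y
      onto       : ∀ y → ∃ λ x → x ~ y
      ≈-refl     : ∀ {x} → x M.≈ᴹ x
      functional : ∀ {x x′ y y′} → x ~ y → x′ ~ y′ → x M.≈ᴹ x′ → y N.≈ᴹ y′
      injective  : ∀ {x x′ y y′} → x ~ y → x′ ~ y′ → y N.≈ᴹ y′ → x M.≈ᴹ x′
      ~-0        : M.0ᴹ ~ N.0ᴹ
      ~-+        : ∀ {x x′ y y′} → x ~ y → x′ ~ y′ → x M.+ᴹ x′ ~ y N.+ᴹ y′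
      ~-neg      : ∀ {x y} → x ~ y → M.-ᴹ x ~ N.-ᴹ y
      ~-*        : ∀ s {x y} → x ~ y → s M.*ₗ x ~ s N.*ₗ y

  linearBijection⇒isomorphism : ∀ {p} → LinearBijection p → ∃ (IsLeftModuleIsomorphism M N)
  linearBijection⇒isomorphism L = f , record
    { isLeftModuleMonomorphism = record
      { isLeftModuleHomomorphism = record
        { +ᴹ-isGroupHomomorphism = record
          { isMonoidHomomorphism = record
            { isMagmaHomomorphism = record
              { isRelHomomorphism = record { cong = functional (f~ _) (f~ _) }
              ; homo = λ x y → functional (f~ _) (~-+ (f~ x) (f~ y)) ≈-refl
              }
            ; ε-homo = functional (f~ _) ~-0 ≈-refl
            }
          ; ⁻¹-homo = λ x → functional (f~ _) (~-neg (f~ x)) ≈-refl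
          }
        ; *ₗ-homo = λ s x → functional (f~ _) (~-* s (f~ x)) ≈-refl
        }
      ; injective = injective (f~ _) (f~ _)
      }
    ; surjective = λ y → proj₁ (onto y) , functional (f~ _) (proj₂ (onto y))
    }
    where
    open LinearBijection L
    f : M.Carrierᴹ → N.Carrierᴹ
    f x = proj₁ (total x)
    f~ : ∀ x → x ~ f x
    f~ x = proj₂ (total x)

-- Graphic arrangements

module GraphicArrangements {c ℓ : Level} (K : CommutativeRing c ℓ) (n : ℕ) where

  open Arrangements K n
  open CommutativeRing S hiding (zero)
  open PolynomialLemmas K
  open Congruences S
  open IntegralSolver S
  open Fractions S using (Regular)
  open Substitution K S (const-isRingHom n) using (evaluate; evaluate-isRingHom; evaluate-const; evaluate-var)
  open BigOperator +-commutativeMonoid using (sum; sum-cong-≋; sum-replicate-zero; ∑-distrib-+)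
  open BigOperator *-commutativeMonoid using () renaming (sum to product)
  open SetoidReasoning setoid
  private
    module RP = RingProperties ring
    module GP = AbelianGroupProperties +-abelianGroup
    module K = CommutativeRing K
    module R = Subrings.Subring R-subring

  -- Substitutions and congruences

  substitute : Vector Carrier n → Carrier → Carrier
  substitute = evaluate n

  module Substitute (y : Vector Carrier n) where
    isRingHom = evaluate-isRingHom n y
    open IsRingHomomorphism isRingHom public

    minus : ∀ a b → substitute y (a - b) ≈ substitute y a - substitute y b
    minus a b = trans (+-homo a (- b)) (+-congˡ (-‿homo b))

    substitute-C : ∀ a → substitute y (C a) ≈ C a
    substitute-C = evaluate-const n y

    substitute-x : ∀ i → substitute y (x i) ≈ y i
    substitute-x = evaluate-var n y

    substitute-difference : ∀ i j → substitute y (x i - x j) ≈ y i - y j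
    substitute-difference i j = trans (minus (x i) (x j)) (+-cong (substitute-x i) (-‿cong (substitute-x j)))

  -- The elements on which two homomorphisms agree modulo `d` form a subring, so `spanned` applies.
  agree-mod : ∀ {φ ψ} → RingHom S S φ → RingHom S S ψ → ∀ d →
              (∀ a → d ∣ φ (C a) - ψ (C a)) → (∀ i → d ∣ φ (x i) - ψ (x i)) →
              ∀ f → d ∣ φ f - ψ f
  agree-mod {φ} {ψ} φ-hom ψ-hom d = spanned n (record
    { _∈ = λ f → d ∣ φ f - ψ f
    ; resp = λ e → ∣ʳ-respʳ-≈ (+-cong (φ.⟦⟧-cong e) (-‿cong (ψ.⟦⟧-cong e)))
    ; 0∈ = ∣-difference (trans φ.0#-homo (sym ψ.0#-homo))
    ; 1∈ = ∣-difference (trans φ.1#-homo (sym ψ.1#-homo))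
    ; +-∈ = λ {a} {b} p q → ∣ʳ-respʳ-≈
        (trans (solve 4 (λ a a′ b b′ → (a :- a′) :+ (b :- b′) := a :+ b :- (a′ :+ b′)) refl (φ a) (ψ a) (φ b) (ψ b))
          (+-cong (sym (φ.+-homo a b)) (-‿cong (sym (ψ.+-homo a b)))))
        (∣-+ p q)
    ; *-∈ = λ {a} {b} p q → ∣ʳ-respʳ-≈
        (+-cong (sym (φ.*-homo a b)) (-‿cong (sym (ψ.*-homo a b))))
        (∣-*-cong p q)
    ; neg-∈ = λ {a} p → ∣ʳ-respʳ-≈
        (trans (sym (GP.⁻¹-∙-comm (φ a) (- ψ a))) (+-cong (sym (φ.-‿homo a)) (-‿cong (sym (ψ.-‿homo a)))))
        (∣-neg p)
    })
    where
    module φ = IsRingHomomorphism φ-hom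
    module ψ = IsRingHomomorphism ψ-hom

  id-isRingHom : RingHom S S id
  id-isRingHom = Identity.isRingHomomorphism _ refl

  substitute-agree : ∀ d y z → (∀ i → d ∣ y i - z i) → ∀ f → d ∣ substitute y f - substitute z f
  substitute-agree d y z e = agree-mod (Substitute.isRingHom y) (Substitute.isRingHom z) d
    (λ a → ∣-difference (trans (Substitute.substitute-C y a) (sym (Substitute.substitute-C z a))))
    (λ i → ∣ʳ-respʳ-≈ (sym (+-cong (Substitute.substitute-x y i) (-‿cong (Substitute.substitute-x z i)))) (e i))

  substitute-near : ∀ d y → (∀ i → d ∣ x i - y i) → ∀ f → d ∣ f - substitute y f
  substitute-near d y e = agree-mod id-isRingHom (Substitute.isRingHom y) d
    (λ a → ∣-difference (sym (Substitute.substitute-C y a)))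
    (λ i → ∣ʳ-respʳ-≈ (sym (+-congˡ (-‿cong (Substitute.substitute-x y i)))) (e i))

  -- If `d` divides `h * f`, the substitution sends `h * f` to 0, hence `f` to 0 by regularity of
  -- the image of `h`. But `f` is congruent to its image modulo `d`.
  substitution-regularMod : ∀ {d h} y → (∀ i → d ∣ x i - y i) → substitute y d ≈ 0# →
                            Regular (substitute y h) → RegularMod d h
  substitution-regularMod {d} {h} y near killed reg {f} (q , qd≈hf) =
    ∣-transfer (substitute-near d y near f) (∣ʳ-respʳ-≈ (sym f≈0) (d ∣0))
    where
    open Substitute y
    f≈0 : substitute y f ≈ 0#
    f≈0 = regular⇒nonzerodivisor reg (begin
      substitute y h * substitute y f   ≈⟨ *-homo h f ⟨
      substitute y (h * f)              ≈⟨ ⟦⟧-cong qd≈hf ⟨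
      substitute y (q * d)              ≈⟨ *-homo q d ⟩
      substitute y q * substitute y d   ≈⟨ *-congˡ killed ⟩
      substitute y q * 0#               ≈⟨ zeroʳ _ ⟩
      0#                                ∎)

  -- Regularity of variables and differences

  set-same : ∀ (g : Vector Carrier n) i {a} → (g [ i ≔ a ]) i ≈ a
  set-same g i = reflexive (updateAt-updates i g)

  set-other : ∀ (g : Vector Carrier n) {i j} {a} → j ≢ i → (g [ i ≔ a ]) j ≈ g j
  set-other g {i} {j} j≢i = reflexive (updateAt-minimal j i g j≢i)

  set-near : ∀ {d} k b → d ≈ x k - b → ∀ i → d ∣ x i - (x [ k ≔ b ]) i
  set-near {d} k b d≈ i with i ≟ k
  ... | yes ≡.refl = ∣ʳ-respʳ-≈ (trans d≈ (+-congˡ (-‿cong (sym (set-same x k))))) ∣ʳ-refl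
  ... | no i≢k     = ∣-difference (sym (set-other x i≢k))

  -- The shear x u ↦ x u + x v turns x u - x v into x u.
  difference-regular : ∀ {u v} → u ≢ v → Regular (x u - x v)
  difference-regular {u} {v} u≢v = nonzerodivisor⇒regular (λ f e → begin
    f                                   ≈⟨ GP.x∙y⁻¹≈ε⇒x≈y _ _ (0∣x⇒x≈0 (unshear f)) ⟩
    substitute z (substitute y f)       ≈⟨ Z.⟦⟧-cong (regular⇒nonzerodivisor (var-regular n u) (begin
        x u * substitute y f                      ≈⟨ *-congʳ sheared ⟨
        substitute y (x u - x v) * substitute y f ≈⟨ Y.*-homo (x u - x v) f ⟨
        substitute y ((x u - x v) * f)            ≈⟨ Y.⟦⟧-cong e ⟩
        substitute y 0#                           ≈⟨ Y.0#-homo ⟩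
        0#                                        ∎)) ⟩
    substitute z 0#                     ≈⟨ Z.0#-homo ⟩
    0#                                  ∎)
    where
    y z : Vector Carrier n
    y = x [ u ≔ x u + x v ]
    z = x [ u ≔ x u - x v ]
    module Y = Substitute y
    module Z = Substitute z

    v≢u : v ≢ u
    v≢u = u≢v ∘ ≡.sym

    sheared : substitute y (x u - x v) ≈ x u
    sheared = trans (Y.substitute-difference u v)
      (trans (+-cong (set-same x u) (-‿cong (set-other x v≢u)))
        (solve 2 (λ a b → a :+ b :- b := a) refl (x u) (x v)))

    zy : ∀ i → substitute z (y i) ≈ x i
    zy i with i ≟ u
    ... | yes ≡.refl = begin
      substitute z (y u)                   ≈⟨ Z.⟦⟧-cong (set-same x u) ⟩
      substitute z (x u + x v)             ≈⟨ Z.+-homo (x u) (x v) ⟩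
      substitute z (x u) + substitute z (x v) ≈⟨ +-cong (trans (Z.substitute-x u) (set-same x u))
                                                        (trans (Z.substitute-x v) (set-other x v≢u)) ⟩
      (x u - x v) + x v                    ≈⟨ solve 2 (λ a b → (a :- b) :+ b := a) refl (x u) (x v) ⟩
      x u                                  ∎
    ... | no i≢u = trans (Z.⟦⟧-cong (set-other x i≢u)) (trans (Z.substitute-x i) (set-other x i≢u))

    -- Divisibility by 0 is vanishing, so `agree-mod` with modulus 0 proves that the composite is
    -- the identity.
    unshear : ∀ f → 0# ∣ f - substitute z (substitute y f)
    unshear = agree-mod id-isRingHom
      (Composition.isRingHomomorphism trans Y.isRingHom Z.isRingHom) 0#
      (λ a → ∣-difference (sym (trans (Z.⟦⟧-cong (Y.substitute-C a)) (Z.substitute-C a))))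
      (λ i → ∣-difference (sym (trans (Z.⟦⟧-cong (Y.substitute-x i)) (zy i))))

  -- Setting `x k` to `x l` can collapse `x u - x v` only if {u,v} is {k,l}; otherwise the image is
  -- again a difference of two distinct variables.
  difference-regularMod : ∀ {u v k l} → u ≢ v → k ≢ l → ¬ (u ≡ k × v ≡ l) → ¬ (u ≡ l × v ≡ k) →
                          RegularMod (x k - x l) (x u - x v)
  difference-regularMod {u} {v} {k} {l} u≢v k≢l ≢kl ≢lk = substitution-regularMod y
    (set-near k (x l) refl)
    (trans (substitute-difference k l)
      (trans (+-cong (set-same x k) (-‿cong (set-other x (k≢l ∘ ≡.sym)))) (-‿inverseʳ _)))
    (Regular-resp (sym (substitute-difference u v)) regular)
    where
    y = x [ k ≔ x l ]
    open Substitute y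
    regular : Regular (y u - y v)
    regular with u ≟ k | v ≟ k
    ... | yes ≡.refl | yes ≡.refl = contradiction ≡.refl u≢v
    ... | yes ≡.refl | no v≢k = Regular-resp (sym (+-cong (set-same x k) (-‿cong (set-other x v≢k))))
      (difference-regular (λ l≡v → ≢kl (≡.refl , ≡.sym l≡v)))
    ... | no u≢k | yes ≡.refl = Regular-resp (sym (+-cong (set-other x u≢k) (-‿cong (set-same x k))))
      (difference-regular (λ u≡l → ≢lk (u≡l , ≡.refl)))
    ... | no u≢k | no v≢k = Regular-resp (sym (+-cong (set-other x u≢k) (-‿cong (set-other x v≢k))))
      (difference-regular u≢v)

  difference-coprime : ∀ {u v k l} → u ≢ v → k ≢ l → ¬ (u ≡ k × v ≡ l) → ¬ (u ≡ l × v ≡ k) →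
                       Coprime (x u - x v) (x k - x l)
  difference-coprime u≢v k≢l ≢kl ≢lk =
      difference-regularMod k≢l u≢v (λ (k≡u , l≡v) → ≢kl (≡.sym k≡u , ≡.sym l≡v))
        (λ (k≡v , l≡u) → ≢lk (≡.sym l≡u , ≡.sym k≡v))
    , difference-regularMod u≢v k≢l ≢kl ≢lk

  module _ (k : Fin n) where

    private
      y = x [ k ≔ 0# ]
      open Substitute y

      sub-0 : ∀ a → a - 0# ≈ a
      sub-0 a = trans (+-congˡ RP.-0#≈0#) (+-identityʳ a)

      modulo-x : ∀ {h} → Regular (substitute y h) → RegularMod (x k) h
      modulo-x = substitution-regularMod y (set-near k 0# (sym (sub-0 _)))
        (trans (substitute-x k) (set-same x k))

    var-regularMod : ∀ {j} → j ≢ k → RegularMod (x k) (x j)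
    var-regularMod {j} j≢k = modulo-x
      (Regular-resp (sym (trans (substitute-x j) (set-other x j≢k))) (var-regular n j))

    -- Setting `x k` to 0 leaves `x u - x v`, `x u` or `- x v`, each of which is regular.
    difference-regularMod-var : ∀ {u v} → u ≢ v → RegularMod (x k) (x u - x v)
    difference-regularMod-var {u} {v} u≢v =
      modulo-x (Regular-resp (sym (substitute-difference u v)) regular)
      where
      regular : Regular (y u - y v)
      regular with u ≟ k | v ≟ k
      ... | yes ≡.refl | yes ≡.refl = contradiction ≡.refl u≢v
      ... | yes ≡.refl | no v≢k = Regular-resp
        (sym (trans (+-cong (set-same x k) (-‿cong (set-other x v≢k))) (+-identityˡ _)))
        (Regular-neg (var-regular n v))
      ... | no u≢k | yes ≡.refl = Regular-resp
        (sym (trans (+-cong (set-other x u≢k) (-‿cong (set-same x k))) (sub-0 _))) (var-regular n u)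
      ... | no u≢k | no v≢k = Regular-resp (sym (+-cong (set-other x u≢k) (-‿cong (set-other x v≢k))))
        (difference-regular u≢v)

  -- Reduction modulo x i, with representatives in R.
  reduce : Fin n → Carrier → Carrier
  reduce i = substitute (λ j → x j - x i)

  module Reduce (i : Fin n) = Substitute (λ j → x j - x i)

  difference∈R : ∀ i j → (x i - x j) R.∈
  difference∈R i j with Fin.<-cmp i j
  ... | tri< i<j _ _    = Subrings.gen (difference i<j)
  ... | tri≈ _ ≡.refl _ = R.resp (sym (-‿inverseʳ _)) R.0∈
  ... | tri> _ _ j<i    = R.resp (GP.⁻¹-anti-homo‿- (x j) (x i)) (R.neg-∈ (Subrings.gen (difference j<i)))

  reduce∈R : ∀ i f → (reduce i f) R.∈
  reduce∈R i = spanned n (record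
    { _∈ = λ f → (reduce i f) R.∈
    ; resp = λ e → R.resp (⟦⟧-cong e)
    ; 0∈ = R.resp (sym 0#-homo) R.0∈
    ; 1∈ = R.resp (sym 1#-homo) R.1∈
    ; +-∈ = λ p q → R.resp (sym (+-homo _ _)) (R.+-∈ p q)
    ; *-∈ = λ p q → R.resp (sym (*-homo _ _)) (R.*-∈ p q)
    ; neg-∈ = λ p → R.resp (sym (-‿homo _)) (R.neg-∈ p)
    })
    (λ a → R.resp (sym (substitute-C a)) (Subrings.gen (scalar a)))
    (λ j → R.resp (sym (substitute-x j)) (difference∈R j i))
    where open Reduce i

  -- The substitution subtracts the same element `x i` from all variables, which changes neither
  -- scalars nor differences.
  reduce-fixes-R : ∀ i {f} → f R.∈ → reduce i f ≈ f
  reduce-fixes-R i = fixed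
    where
    open Reduce i
    fixed : ∀ {f} → f R.∈ → reduce i f ≈ f
    fixed (Subrings.gen (scalar a)) = substitute-C a
    fixed (Subrings.gen (difference {j} {k} _)) = trans (substitute-difference j k)
      (solve 3 (λ a b d → (a :- d) :- (b :- d) := a :- b) refl (x j) (x k) (x i))
    fixed (Subrings.resp e p) = trans (⟦⟧-cong (sym e)) (trans (fixed p) e)
    fixed Subrings.0∈         = 0#-homo
    fixed Subrings.1∈         = 1#-homo
    fixed (Subrings.+-∈ p q)  = trans (+-homo _ _) (+-cong (fixed p) (fixed q))
    fixed (Subrings.*-∈ p q)  = trans (*-homo _ _) (*-cong (fixed p) (fixed q))
    fixed (Subrings.neg-∈ p)  = trans (-‿homo _) (-‿cong (fixed p))

  reduce-near : ∀ i f → x i ∣ f - reduce i f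
  reduce-near i = substitute-near (x i) (λ j → x j - x i) (λ j →
    ∣ʳ-respʳ-≈ (solve 2 (λ a b → b := a :- (a :- b)) refl (x j) (x i)) ∣ʳ-refl)

  reduce-x : ∀ i → reduce i (x i) ≈ 0#
  reduce-x i = trans (Reduce.substitute-x i i) (-‿inverseʳ (x i))

  -- `reduce i` is the identity on R and kills `x i`: R meets the ideal of `x i` only in 0, which
  -- makes representatives in R unique.
  R∩⟨x⟩ : ∀ i {f} → f R.∈ → x i ∣ f → f ≈ 0#
  R∩⟨x⟩ i {f} f∈R (q , qx≈f) = begin
    f                             ≈⟨ reduce-fixes-R i f∈R ⟨
    reduce i f                    ≈⟨ ⟦⟧-cong qx≈f ⟨
    reduce i (q * x i)            ≈⟨ *-homo q (x i) ⟩
    reduce i q * reduce i (x i)   ≈⟨ *-congˡ (reduce-x i) ⟩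
    reduce i q * 0#               ≈⟨ zeroʳ _ ⟩
    0#                            ∎
    where open Reduce i

  -- The two points of substitution differ by `x v - x u` in every coordinate.
  reduce-agree : ∀ u v f → x u - x v ∣ reduce u f - reduce v f
  reduce-agree u v = substitute-agree (x u - x v) (λ j → x j - x u) (λ j → x j - x v) (λ j →
    ∣ʳ-respʳ-≈ (solve 3 (λ u v j → :- (u :- v) := (j :- u) :- (j :- v)) refl (x u) (x v) (x j)) (∣-neg ∣ʳ-refl))

  -- The denominators `P` and their factors

  module Poles where

    -- The entry at `u` would be 0 and is replaced by 1 instead of being removed. The index set then
    -- does not depend on `u`, so that factors for different vertices can be compared entry by
    -- entry.
    factors : Fin n → Vector Carrier n
    factors u = (λ j → x j - x u) [ u ≔ 1# ]

    -- Modulo x u this is the product of the x j with j ≢ u.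
    P : Fin n → Carrier
    P u = product (factors u)

    factors-elim : ∀ {p} (T : Carrier → Set p) (g : Vector Carrier n) u → T 1# →
                   (∀ j → j ≢ u → T (g j)) → ∀ j → T ((g [ u ≔ 1# ]) j)
    factors-elim T g u t1 tg j with j ≟ u
    ... | yes ≡.refl = ≡.subst T (≡.sym (updateAt-updates u g)) t1
    ... | no j≢u     = ≡.subst T (≡.sym (updateAt-minimal j u g j≢u)) (tg j j≢u)

    P-regular : ∀ u → Regular (P u)
    P-regular u = Regular-product (factors u)
      (factors-elim Regular _ u (Fractions.1-regular S) (λ j → difference-regular))

    -- Every factor of `P k` other than 1 involves `x k`, so none is `x u - x v` up to sign.
    P-regularMod : ∀ {u v k} → u ≢ v → k ≢ u → k ≢ v → RegularMod (x u - x v) (P k)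
    P-regularMod u≢v k≢u k≢v = RegularMod-product (factors _)
      (factors-elim (RegularMod _) _ _ RegularMod-1 (λ j j≢k → difference-regularMod j≢k u≢v
        (λ (_ , k≡v) → k≢v k≡v) (λ (_ , k≡u) → k≢u k≡u)))

    P∈R : ∀ u → (P u) R.∈
    P∈R u = product∈ (factors u) (factors-elim R._∈ _ u R.1∈ (λ j _ → difference∈R j u))
      where
      product∈ : ∀ {m} (g : Vector Carrier m) → (∀ i → (g i) R.∈) → (product g) R.∈
      product∈ {zero}  g g∈ = R.1∈
      product∈ {suc m} g g∈ = R.*-∈ (g∈ zero) (product∈ (g ∘ suc) (g∈ ∘ suc))

    difference∣P : ∀ {u j} → j ≢ u → x j - x u ∣ P u
    difference∣P {u} {j} j≢u = ∣ʳ-respˡ-≈ (set-other _ j≢u) (∣-product (factors u) j)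

    P-∣ : ∀ {u f} → (∀ j → j ≢ u → x j - x u ∣ f) → P u ∣ f
    P-∣ {u} {f} div = product-∣ (factors u)
      (λ {i} {j} → coprime i j)
      (factors-elim (_∣ f) _ u (f , *-identityʳ f) div)
      where
      coprime : ∀ i j → i ≢ j → Coprime (factors u i) (factors u j)
      coprime i j i≢j with i ≟ u | j ≟ u
      ... | yes ≡.refl | _ = Coprime-respˡ (sym (set-same _ u)) Coprime-1ˡ
      ... | no i≢u | yes ≡.refl = Coprime-sym (Coprime-respˡ (sym (set-same _ u)) Coprime-1ˡ)
      ... | no i≢u | no j≢u = Coprime-respˡ (sym (set-other _ i≢u))
        (Coprime-sym (Coprime-respˡ (sym (set-other _ j≢u)) (difference-coprime j≢u i≢u
          (λ (j≡i , _) → i≢j (≡.sym j≡i)) (λ (j≡u , _) → j≢u j≡u))))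

    remaining : Fin n → Fin n → Carrier
    remaining u v = product (factors u [ v ≔ 1# ])

    P-extract : ∀ {u v} → v ≢ u → P u ≈ (x v - x u) * remaining u v
    P-extract {u} {v} v≢u = trans (product-extract (factors u) v) (*-congʳ (set-other _ v≢u))

    remaining-regularMod : ∀ {u v} → u ≢ v → RegularMod (x u - x v) (remaining u v)
    remaining-regularMod {u} {v} u≢v = RegularMod-product (factors u [ v ≔ 1# ]) regular
      where
      regular : ∀ j → RegularMod (x u - x v) ((factors u [ v ≔ 1# ]) j)
      regular j with j ≟ u | j ≟ v
      ... | _ | yes ≡.refl = RegularMod-resp (sym (set-same (factors u) v)) RegularMod-1
      ... | yes ≡.refl | no j≢v =
        RegularMod-resp (sym (trans (set-other (factors u) j≢v) (set-same _ u))) RegularMod-1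
      ... | no j≢u | no j≢v =
        RegularMod-resp (sym (trans (set-other (factors u) j≢v) (set-other _ j≢u)))
          (difference-regularMod j≢u u≢v (λ (j≡u , _) → j≢u j≡u) (λ (j≡v , _) → j≢v j≡v))

    -- At `u` and at `v` both entries are 1; elsewhere `x j - x u` and `x j - x v` are congruent.
    remaining-agree : ∀ {u v} → u ≢ v → x u - x v ∣ remaining u v - remaining v u
    remaining-agree {u} {v} u≢v = ∣-product-cong (factors u [ v ≔ 1# ]) (factors v [ u ≔ 1# ]) agree
      where
      agree : ∀ j → x u - x v ∣ (factors u [ v ≔ 1# ]) j - (factors v [ u ≔ 1# ]) j
      agree j with j ≟ u | j ≟ v
      ... | yes ≡.refl | yes ≡.refl = contradiction ≡.refl u≢v
      ... | yes ≡.refl | no j≢v = ∣-difference (trans (set-other (factors u) j≢v)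
        (trans (set-same _ u) (sym (set-same (factors v) u))))
      ... | no j≢u | yes ≡.refl = ∣-difference (trans (set-same (factors u) v)
        (sym (trans (set-other (factors v) j≢u) (set-same _ v))))
      ... | no j≢u | no j≢v = ∣ʳ-respʳ-≈
        (trans (solve 3 (λ u v j → :- (u :- v) := (j :- u) :- (j :- v)) refl (x u) (x v) (x j))
          (+-cong (sym (trans (set-other (factors u) j≢v) (set-other _ j≢u)))
            (-‿cong (sym (trans (set-other (factors v) j≢u) (set-other _ j≢v))))))
        (∣-neg ∣ʳ-refl)

  -- Edge forms and the wedge condition

  sum-single : ∀ {m} (g : Vector Carrier m) u → (∀ i → i ≢ u → g i ≈ 0#) → sum g ≈ g u
  sum-single {suc m} g zero g≈0 = trans
    (+-congˡ (trans (sum-cong-≋ (λ i → g≈0 (suc i) (λ ()))) (sum-replicate-zero m))) (+-identityʳ _)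
  sum-single {suc m} g (suc u) g≈0 = trans
    (+-cong (g≈0 zero (λ ())) (sum-single (g ∘ suc) u (λ i i≢u → g≈0 (suc i) (i≢u ∘ suc-injective))))
    (+-identityˡ _)

  module C = IsRingHomomorphism (const-isRingHom n)

  basis-same : ∀ u → C (basisForm u u) ≈ 1#
  basis-same u with u ≟ u
  ... | yes _  = C.1#-homo
  ... | no u≢u = contradiction ≡.refl u≢u

  basis-other : ∀ {u i} → i ≢ u → C (basisForm u i) ≈ 0#
  basis-other {u} {i} i≢u with u ≟ i
  ... | yes u≡i = contradiction (≡.sym u≡i) i≢u
  ... | no _    = C.0#-homo

  edgeForm : Fin n × Fin n → LinearForm
  edgeForm (u , v) i = basisForm u i K.- basisForm v i

  edgeForm-coefficient : ∀ u v i → C (edgeForm (u , v) i) ≈ C (basisForm u i) - C (basisForm v i)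
  edgeForm-coefficient u v i = trans (C.+-homo _ _) (+-congˡ (C.-‿homo _))

  poly-edgeForm : ∀ u v → poly (edgeForm (u , v)) ≈ x u - x v
  poly-edgeForm u v = begin
    sum (λ i → C (edgeForm (u , v) i) * x i)
      ≈⟨ sum-cong-≋ (λ i → trans (*-congʳ (edgeForm-coefficient u v i)) (distribʳ (x i) _ _)) ⟩
    sum (λ i → C (basisForm u i) * x i + - C (basisForm v i) * x i)
      ≈⟨ ∑-distrib-+ {n} _ _ ⟩
    sum (λ i → C (basisForm u i) * x i) + sum (λ i → - C (basisForm v i) * x i)
      ≈⟨ +-cong (sum-single _ u (λ i i≢u → trans (*-congʳ (basis-other i≢u)) (zeroˡ _)))
                (sum-single _ v (λ i i≢v → trans (*-congʳ (trans (-‿cong (basis-other i≢v)) RP.-0#≈0#)) (zeroˡ _))) ⟩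
    C (basisForm u u) * x u + - C (basisForm v v) * x v
      ≈⟨ +-cong (trans (*-congʳ (basis-same u)) (*-identityˡ _))
                (trans (*-congʳ (-‿cong (basis-same v))) (RP.-1*x≈-x _)) ⟩
    x u - x v ∎

  -- The wedge condition in coordinates: modulo `x u - x v` the numerator is a multiple of dxᵤ -
  -- dxᵥ. Thus only the coefficients at `u` and `v` may have a pole there, with opposite residues.
  Residues : Vector Carrier n → Fin n × Fin n → Set (c ⊔ ℓ)
  Residues η (u , v) = (∀ k → k ≢ u → k ≢ v → x u - x v ∣ η k) × x u - x v ∣ η u + η v

  module _ (η : Vector Carrier n) {u v : Fin n} (u<v : u < v) where

    private
      α = edgeForm (u , v)

      u≢v : u ≢ v
      u≢v = Fin.<⇒≢ u<v

      at-u : C (α u) ≈ 1#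
      at-u = trans (edgeForm-coefficient u v u)
        (trans (+-cong (basis-same u) (trans (-‿cong (basis-other u≢v)) RP.-0#≈0#)) (+-identityʳ _))

      at-v : C (α v) ≈ - 1#
      at-v = trans (edgeForm-coefficient u v v)
        (trans (+-cong (basis-other (u≢v ∘ ≡.sym)) (-‿cong (basis-same v))) (+-identityˡ _))

      elsewhere : ∀ {k} → k ≢ u → k ≢ v → C (α k) ≈ 0#
      elsewhere k≢u k≢v = trans (edgeForm-coefficient u v _)
        (trans (+-cong (basis-other k≢u) (trans (-‿cong (basis-other k≢v)) RP.-0#≈0#)) (+-identityʳ _))

      wedge : Fin n → Fin n → Carrier
      wedge i j = η i * C (α j) - η j * C (α i)

      wedge-uv : wedge u v ≈ - (η u + η v)
      wedge-uv = trans (+-cong (*-congˡ at-v) (-‿cong (*-congˡ at-u)))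
        (trans (+-cong (trans (*-comm _ _) (RP.-1*x≈-x _)) (-‿cong (*-identityʳ _))) (GP.⁻¹-∙-comm (η u) (η v)))

    residues : WedgeDivides η α → Residues η (u , v)
    residues (θ , eq) = simple , sum-divisible
      where
      ordered : ∀ {i j} → i < j → x u - x v ∣ wedge i j
      ordered i<j = ∣ʳ-respˡ-≈ (poly-edgeForm u v) (θ (_ , _ , i<j) , trans (*-comm _ _) (sym (eq (_ , _ , i<j))))

      -- Two-forms have coordinates only for `i < j`; the other order follows by antisymmetry.
      unordered : ∀ {i j} → i ≢ j → x u - x v ∣ wedge i j
      unordered {i} {j} i≢j with Fin.<-cmp i j
      ... | tri< i<j _ _ = ordered i<j
      ... | tri≈ _ i≡j _ = contradiction i≡j i≢j
      ... | tri> _ _ j<i = ∣ʳ-respʳ-≈ (GP.⁻¹-anti-homo‿- _ _) (∣-neg (ordered j<i))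

      simple : ∀ k → k ≢ u → k ≢ v → x u - x v ∣ η k
      simple k k≢u k≢v = ∣ʳ-respʳ-≈ (begin
        η k * C (α u) - η u * C (α k)   ≈⟨ +-cong (*-congˡ at-u) (-‿cong (*-congˡ (elsewhere k≢u k≢v))) ⟩
        η k * 1# - η u * 0#             ≈⟨ +-cong (*-identityʳ _) (trans (-‿cong (zeroʳ _)) RP.-0#≈0#) ⟩
        η k + 0#                        ≈⟨ +-identityʳ _ ⟩
        η k                             ∎) (unordered k≢u)

      sum-divisible : x u - x v ∣ η u + η v
      sum-divisible = ∣ʳ-respʳ-≈ (trans (-‿cong wedge-uv) (GP.⁻¹-involutive _)) (∣-neg (ordered u<v))

    wedgeDivides : Residues η (u , v) → WedgeDivides η α
    wedgeDivides (simple , sum-divisible) =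
      (λ p → _∣ʳ_.quotient (divides p)) , (λ p → trans (sym (_∣ʳ_.equality (divides p)))
        (trans (*-comm _ _) (*-congʳ (sym (poly-edgeForm u v)))))
      where
      zero-coefficient : ∀ {a b} → b ≈ 0# → x u - x v ∣ a * b
      zero-coefficient b≈0 = ∣ʳ-respʳ-≈ (sym (trans (*-congˡ b≈0) (zeroʳ _))) (_ ∣0)

      off-edge : ∀ {i} j → i ≢ u → i ≢ v → x u - x v ∣ wedge i j
      off-edge {i} j i≢u i≢v =
        ∣-minus (∣-*ʳ _ (simple i i≢u i≢v)) (zero-coefficient (elsewhere i≢u i≢v))

      -- If `i` or `j` is off the edge, that index decides. Otherwise the two orderings force `i` to
      -- be `u` and `j` to be `v`, and the residue sum is used.
      divides : ∀ p → x u - x v ∣ (η ∧ d α) p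
      divides (i , j , i<j) with i ≟ u | i ≟ v | j ≟ u | j ≟ v
      ... | no i≢u | no i≢v | _ | _ = off-edge j i≢u i≢v
      ... | _ | _ | no j≢u | no j≢v = ∣ʳ-respʳ-≈ (GP.⁻¹-anti-homo‿- _ _) (∣-neg (off-edge i j≢u j≢v))
      ... | yes ≡.refl | _ | _ | yes ≡.refl = ∣ʳ-respʳ-≈ (sym wedge-uv) (∣-neg sum-divisible)
      ... | yes ≡.refl | _ | yes ≡.refl | _ = contradiction ≡.refl (Fin.<⇒≢ i<j)
      ... | _ | yes ≡.refl | _ | yes ≡.refl = contradiction ≡.refl (Fin.<⇒≢ i<j)
      ... | _ | yes ≡.refl | yes ≡.refl | _ = contradiction i<j (Fin.<-asym u<v)

  -- Cancelling `x u - x v` in the two equations gives `- A * η u ≈ q * r u` and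
  -- `B * η v ≈ q * r v`. The signs are opposite because `P u` contains `x v - x u` while `P v`
  -- contains `x u - x v`. As `A` and `B` are congruent, the difference of the `r` is tied to the
  -- sum of the `η`.
  edge-congruence : ∀ {u v Δ q} {η r : Vector Carrier n} → u ≢ v → let open Poles in
    Δ ≈ (x u - x v) * q → P u * η u ≈ Δ * r u → P v * η v ≈ Δ * r v →
    x u - x v ∣ q * (r u - r v) + remaining u v * (η u + η v)
  edge-congruence {u} {v} {Δ} {q} {η} {r} u≢v Δ≈ eq-u eq-v = ∣ʳ-respʳ-≈ (begin
    (A - B) * η v
      ≈⟨ solve 4 (λ a b s t → (a :- b) :* t := (:- a :* s :- b :* t) :+ a :* (s :+ t)) refl A B (η u) (η v) ⟩
    (- A * η u - B * η v) + A * (η u + η v)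
      ≈⟨ +-congʳ (+-cong cancel-u (-‿cong cancel-v)) ⟩
    (q * r u - q * r v) + A * (η u + η v)
      ≈⟨ +-congʳ (RP.x[y-z]≈xy-xz q (r u) (r v)) ⟨
    q * (r u - r v) + A * (η u + η v) ∎)
    (∣-*ʳ (η v) (remaining-agree u≢v))
    where
    open Poles
    A = remaining u v
    B = remaining v u

    cancel-u : - A * η u ≈ q * r u
    cancel-u = difference-regular u≢v (begin
      (x u - x v) * (- A * η u)
        ≈⟨ solve 4 (λ a b A h → (a :- b) :* (:- A :* h) := (b :- a) :* A :* h) refl (x u) (x v) A (η u) ⟩
      (x v - x u) * A * η u           ≈⟨ *-congʳ (P-extract (u≢v ∘ ≡.sym)) ⟨
      P u * η u                       ≈⟨ eq-u ⟩
      Δ * r u                         ≈⟨ *-congʳ Δ≈ ⟩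
      (x u - x v) * q * r u           ≈⟨ *-assoc _ _ _ ⟩
      (x u - x v) * (q * r u)         ∎)

    cancel-v : B * η v ≈ q * r v
    cancel-v = difference-regular u≢v (begin
      (x u - x v) * (B * η v)         ≈⟨ *-assoc _ _ _ ⟨
      (x u - x v) * B * η v           ≈⟨ *-congʳ (P-extract u≢v) ⟨
      P v * η v                       ≈⟨ eq-v ⟩
      Δ * r v                         ≈⟨ *-congʳ Δ≈ ⟩
      (x u - x v) * q * r v           ≈⟨ *-assoc _ _ _ ⟩
      (x u - x v) * (q * r v)         ∎)

  -- The defining polynomial of the arrangement

  module _ (G : SimpleGraph n) where

    open SimpleGraph G
    open Poles

    difference-of : Fin n × Fin n → Carrier
    difference-of (u , v) = x u - x v

    -- This is Q with literal differences as factors in place of the sums that `poly` produces.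
    Δ : Carrier
    Δ = productₗ (List.map difference-of (edges G))

    Q≈Δ : Q (graphicArrangement G) ≈ Δ
    Q≈Δ = go (edges G)
      where
      go : ∀ es → Q (List.map edgeForm es) ≈ productₗ (List.map difference-of es)
      go []              = refl
      go ((u , v) ∷ es) = *-cong (poly-edgeForm u v) (go es)

    pairs : List (Fin n × Fin n)
    pairs = List.cartesianProduct (List.allFin n) (List.allFin n)

    listed? : Decidable (λ ((u , v) : Fin n × Fin n) → u < v × Adj u v)
    listed? (u , v) = (u Fin.<? v) ×-dec adj? u v

    edges-sound : All (λ (u , v) → u < v × Adj u v) (edges G)
    edges-sound = All.all-filter listed? pairs

    edges-complete : ∀ {u v} → u < v → Adj u v → (u , v) ∈ edges G
    edges-complete u<v uv = ∈-filter⁺ listed? (∈-cartesianProduct⁺ (∈-allFin _) (∈-allFin _)) (u<v , uv)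

    allEdges : ∀ {p} {T : Carrier → Set p} → (∀ {u v} → u < v → Adj u v → T (x u - x v)) →
               All T (List.map difference-of (edges G))
    allEdges t = All.map⁺ (All.map (λ (u<v , uv) → t u<v uv) edges-sound)

    -- Edges are listed once and in increasing order, so two entries are neither equal nor reverses
    -- of each other.
    edges-coprime : AllPairs Coprime (List.map difference-of (edges G))
    edges-coprime = AllPairs.map⁺ (go edges-sound
      (Unique.filter⁺ listed? (Unique.cartesianProduct⁺ (Unique.allFin⁺ n) (Unique.allFin⁺ n))))
      where
      distinct : ∀ {e f} → proj₁ e < proj₂ e → proj₁ f < proj₂ f → e ≢ f →
                 Coprime (difference-of e) (difference-of f)
      distinct u<v k<l e≢f = difference-coprime (Fin.<⇒≢ u<v) (Fin.<⇒≢ k<l)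
        (λ { (≡.refl , ≡.refl) → e≢f ≡.refl })
        (λ { (≡.refl , ≡.refl) → Fin.<-asym u<v k<l })

      go : ∀ {es} → All (λ (u , v) → u < v × Adj u v) es → Unique es →
           AllPairs (λ e f → Coprime (difference-of e) (difference-of f)) es
      go [] [] = []
      go ((u<v , _) ∷ s) (≢s ∷ unique) =
        All.zipWith (λ ((k<l , _) , e≢f) → distinct u<v k<l e≢f) (s , ≢s) ∷ go s unique

    Δ-regular : Regular Δ
    Δ-regular = Regular-productₗ (allEdges (λ u<v _ → difference-regular (Fin.<⇒≢ u<v)))

    Δ-regularMod-var : ∀ i → RegularMod (x i) Δ
    Δ-regularMod-var i =
      RegularMod-productₗ (allEdges (λ u<v _ → difference-regularMod-var i (Fin.<⇒≢ u<v)))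

    Δ-regularMod-nonedge : ∀ {k l} → k ≢ l → ¬ Adj k l → RegularMod (x k - x l) Δ
    Δ-regularMod-nonedge k≢l ¬kl = RegularMod-productₗ (allEdges (λ u<v uv →
      difference-regularMod (Fin.<⇒≢ u<v) k≢l
        (λ { (≡.refl , ≡.refl) → ¬kl uv }) (λ { (≡.refl , ≡.refl) → ¬kl (symm uv) })))

    Δ∈R : Δ R.∈
    Δ∈R = go (edges G)
      where
      go : ∀ es → (productₗ (List.map difference-of es)) R.∈
      go []              = R.1∈
      go ((u , v) ∷ es) = R.*-∈ (difference∈R u v) (go es)

    swap-∣ : ∀ {u v f} → x u - x v ∣ f → x v - x u ∣ f
    swap-∣ = ∣ʳ-respˡ-≈ (GP.⁻¹-anti-homo‿- _ _) ∘ neg-∣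

    swap-congruence : ∀ {u v a b} → x u - x v ∣ a - b → x v - x u ∣ b - a
    swap-congruence p = ∣ʳ-respʳ-≈ (GP.⁻¹-anti-homo‿- _ _) (∣-neg (swap-∣ p))

    edge∣Δ : ∀ {u v} → Adj u v → x u - x v ∣ Δ
    edge∣Δ {u} {v} uv with Fin.<-cmp u v
    ... | tri< u<v _ _    = ∣⇒∣productₗ (∈-map⁺ difference-of (edges-complete u<v uv))
    ... | tri≈ _ u≡v _    = contradiction uv (irrefl u≡v)
    ... | tri> _ _ v<u    = swap-∣ (∣⇒∣productₗ (∈-map⁺ difference-of (edges-complete v<u (symm uv))))

    -- The correspondence between numerators and polynomials

    Logarithmic : Vector Carrier n → Set _
    Logarithmic η = ∀ {u v} → u < v → Adj u v → Residues η (u , v)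

    -- η i / Q is the reduction of f modulo x i divided by P i; not naming the
    -- reduction makes the relation visibly linear.
    Corresponds : Vector Carrier n → Carrier → Set _
    Corresponds η f = ∀ i → x i ∣ Δ * f - P i * η i

    corresponds-0 : Corresponds (λ _ → 0#) 0#
    corresponds-0 i = ∣-difference (trans (zeroʳ Δ) (sym (zeroʳ (P i))))

    -- The numerator is `- 1# * η i` because membership of a negative in a submodule is derived from
    -- scaling by -1.
    corresponds-neg : ∀ {η f} → Corresponds η f → Corresponds (λ i → - 1# * η i) (- f)
    corresponds-neg {η} {f} p i = ∣ʳ-respʳ-≈ (begin
      - (Δ * f - P i * η i)           ≈⟨ solve 4 (λ D f P h → :- (D :* f :- P :* h) := D :* (:- f) :- P :* (:- h)) refl Δ f (P i) (η i) ⟩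
      Δ * - f - P i * - η i           ≈⟨ +-congˡ (-‿cong (*-congˡ (RP.-1*x≈-x (η i)))) ⟨
      Δ * - f - P i * (- 1# * η i)    ∎) (∣-neg (p i))

    corresponds-+ : ∀ {η η′ f f′} → Corresponds η f → Corresponds η′ f′ →
                    Corresponds (λ i → η i + η′ i) (f + f′)
    corresponds-+ {η} {η′} {f} {f′} p q i = ∣ʳ-respʳ-≈
      (solve 6 (λ D f f′ P h h′ → (D :* f :- P :* h) :+ (D :* f′ :- P :* h′) := D :* (f :+ f′) :- P :* (h :+ h′))
        refl Δ f f′ (P i) (η i) (η′ i))
      (∣-+ (p i) (q i))

    corresponds-* : ∀ s {η f} → Corresponds η f → Corresponds (λ i → s * η i) (s * f)
    corresponds-* s {η} {f} p i = ∣ʳ-respʳ-≈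
      (solve 5 (λ s D f P h → s :* (D :* f :- P :* h) := D :* (s :* f) :- P :* (s :* h)) refl s Δ f (P i) (η i))
      (x∣ʳy⇒x∣ʳzy s (p i))

    corresponds-- : ∀ {η η′ f f′} → Corresponds η f → Corresponds η′ f′ →
                    Corresponds (λ i → η i - η′ i) (f - f′)
    corresponds-- {η} {η′} {f} {f′} p q i = ∣ʳ-respʳ-≈
      (solve 6 (λ D f f′ P h h′ → (D :* f :- P :* h) :- (D :* f′ :- P :* h′) := D :* (f :- f′) :- P :* (h :- h′))
        refl Δ f f′ (P i) (η i) (η′ i))
      (∣-minus (p i) (q i))

    -- Each `x i` divides `Δ * f`, hence `f`, because `Δ` is regular modulo `x i`; the variables are
    -- pairwise coprime.
    corresponds-0⇒∣ : ∀ {η f} → (∀ i → η i ≈ 0#) → Corresponds η f → product x ∣ f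
    corresponds-0⇒∣ {η} {f} η≈0 p = product-∣ x
      (λ i≢j → var-regularMod _ (i≢j ∘ ≡.sym) , var-regularMod _ i≢j)
      (λ i → Δ-regularMod-var i (∣ʳ-respʳ-≈ (begin
        Δ * f - P i * η i   ≈⟨ +-congˡ (-‿cong (trans (*-congˡ (η≈0 i)) (zeroʳ _))) ⟩
        Δ * f - 0#          ≈⟨ trans (+-congˡ RP.-0#≈0#) (+-identityʳ _) ⟩
        Δ * f               ∎) (p i)))

    -- `P i * η i` is then a multiple of `x i` that lies in R, so it vanishes, and `P i` can be
    -- cancelled.
    corresponds-∣⇒0 : ∀ {η f} → (∀ i → (η i) R.∈) → Corresponds η f → product x ∣ f → ∀ i → η i ≈ 0#
    corresponds-∣⇒0 {η} {f} η∈R p x∣f i = regular⇒nonzerodivisor (P-regular i)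
      (R∩⟨x⟩ i (R.*-∈ (P∈R i) (η∈R i)) (∣ʳ-respʳ-≈
        (solve 2 (λ a b → a :- (a :- b) := b) refl (Δ * f) (P i * η i))
        (∣-minus (x∣ʳy⇒x∣ʳzy Δ (∣ʳ-trans (∣-product x i) x∣f)) (p i))))

    -- η i / Q = r i / P i
    module FromResidues (η r : Vector Carrier n) (eq : ∀ i → P i * η i ≈ Δ * r i) where

      corresponds : ∀ {f} → (∀ i → x i ∣ f - r i) → Corresponds η f
      corresponds {f} p i = ∣ʳ-respʳ-≈
        (trans (RP.x[y-z]≈xy-xz Δ f (r i)) (+-congˡ (-‿cong (sym (eq i))))) (x∣ʳy⇒x∣ʳzy Δ (p i))

      -- `P u` contains the factor of the nonedge up to sign, whereas `Δ` is regular modulo it.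
      nonedge∣r : ∀ {u v} → u ≢ v → ¬ Adj u v → x u - x v ∣ r u
      nonedge∣r {u} {v} u≢v ¬uv = Δ-regularMod-nonedge u≢v ¬uv
        (∣ʳ-respʳ-≈ (eq u) (∣-*ʳ (η u) (swap-∣ (difference∣P (u≢v ∘ ≡.sym)))))

      module _ {u v} (u<v : u < v) (uv : Adj u v) where

        private
          u≢v = Fin.<⇒≢ u<v
          cofactor = productₗ-cofactor edges-coprime (∈-map⁺ difference-of (edges-complete u<v uv))
          q = proj₁ cofactor
          A = remaining u v

          congruence : x u - x v ∣ q * (r u - r v) + A * (η u + η v)
          congruence = edge-congruence u≢v (proj₁ (proj₂ cofactor)) (eq u) (eq v)

        -- Both `q` and `A` are regular modulo `x u - x v`, so `congruence` can be read in either
        -- direction; `edge-η` is the other one.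
        edge-r : x u - x v ∣ η u + η v → x u - x v ∣ r u - r v
        edge-r p = proj₂ (proj₂ cofactor) (∣ʳ-respʳ-≈
          (solve 2 (λ a b → (a :+ b) :- b := a) refl (q * (r u - r v)) (A * (η u + η v)))
          (∣-minus congruence (x∣ʳy⇒x∣ʳzy A p)))

        edge-η : x u - x v ∣ r u - r v → x u - x v ∣ η u + η v
        edge-η p = remaining-regularMod u≢v (∣ʳ-respʳ-≈
          (solve 2 (λ a b → (a :+ b) :- a := b) refl (q * (r u - r v)) (A * (η u + η v)))
          (∣-minus congruence (x∣ʳy⇒x∣ʳzy q p)))

      -- At an edge the residues cancel; at a nonedge both values are divisible by the difference.
      r-congruent : Logarithmic η → ∀ u v → x u - x v ∣ r u - r v
      r-congruent log u v with Fin.<-cmp u v | adj? u v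
      ... | tri≈ _ ≡.refl _ | _     = ∣-difference refl
      ... | tri< u<v _ _ | yes uv   = edge-r u<v uv (proj₂ (log u<v uv))
      ... | tri> _ _ v<u | yes uv   = swap-congruence (edge-r v<u (symm uv) (proj₂ (log v<u (symm uv))))
      ... | tri< _ u≢v _ | no ¬uv   = ∣-minus (nonedge∣r u≢v ¬uv) (swap-∣ (nonedge∣r (u≢v ∘ ≡.sym) (¬uv ∘ symm)))
      ... | tri> _ u≢v _ | no ¬uv   = ∣-minus (nonedge∣r u≢v ¬uv) (swap-∣ (nonedge∣r (u≢v ∘ ≡.sym) (¬uv ∘ symm)))

      -- For `k` off the edge, `x u - x v` divides `Δ * r k`, which is `P k * η k`, and `P k` can be
      -- cancelled.
      η-logarithmic : (∀ u v → x u - x v ∣ r u - r v) → Logarithmic η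
      η-logarithmic r-cong {u} {v} u<v uv =
          (λ k k≢u k≢v → P-regularMod (Fin.<⇒≢ u<v) k≢u k≢v
            (∣ʳ-respʳ-≈ (sym (eq k)) (∣-*ʳ (r k) (edge∣Δ uv))))
        , edge-η u<v uv (r-cong u v)

    -- An edge at `i` contributes a factor of `P i`; for any other edge the factor divides `η i`.
    -- The quotient supplies the value to be interpolated at `i`.
    Δ∣Pη : ∀ {η} → Logarithmic η → ∀ i → Δ ∣ P i * η i
    Δ∣Pη {η} log i = productₗ-∣ edges-coprime (allEdges divides)
      where
      divides : ∀ {u v} → u < v → Adj u v → x u - x v ∣ P i * η i
      divides {u} {v} u<v uv with i ≟ u | i ≟ v
      ... | yes ≡.refl | _ = ∣-*ʳ _ (swap-∣ (difference∣P (Fin.<⇒≢ u<v ∘ ≡.sym)))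
      ... | no _ | yes ≡.refl = ∣-*ʳ _ (difference∣P (Fin.<⇒≢ u<v))
      ... | no i≢u | no i≢v = x∣ʳy⇒x∣ʳzy _ (proj₁ (log u<v uv) i i≢u i≢v)

    -- Interpolation also asks for `i` equal to `j`. The modulus is then 0, and regularity modulo 0
    -- follows from plain regularity.
    interpolable : ∀ {i j k} → i ≢ k → j ≢ k → RegularMod (x i - x j) (x i - x k)
    interpolable {i} {j} {k} i≢k j≢k with i ≟ j
    ... | no i≢j     = difference-regularMod i≢k i≢j (λ (_ , k≡j) → j≢k (≡.sym k≡j)) (λ (i≡j , _) → i≢j i≡j)
    ... | yes ≡.refl = λ p → ∣ʳ-respʳ-≈
      (sym (regular⇒nonzerodivisor (difference-regular i≢k) (0∣x⇒x≈0 (∣ʳ-respˡ-≈ (-‿inverseʳ _) p)))) (_ ∣0)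

    -- From forms to the cover ideal and back

    InCoverIdeal : Carrier → Set _
    InCoverIdeal = Submodule._∈ (coverIdeal (complement G))

    form⇒ideal : ∀ {η} → Logarithmic η → ∃ λ f → InCoverIdeal f × Corresponds η f
    form⇒ideal {η} log = f , in-ideal , corresponds (proj₂ interpolant)
      where
      r : Vector Carrier n
      r i = _∣ʳ_.quotient (Δ∣Pη log i)

      open FromResidues η r (λ i → trans (sym (_∣ʳ_.equality (Δ∣Pη log i))) (*-comm _ _))

      interpolant = interpolate x r interpolable (r-congruent log)
      f = proj₁ interpolant

      -- `f` is `r u` plus a multiple of `x u`, and `r u` is a multiple of `x u - x v` at a nonedge.
      in-ideal : InCoverIdeal f
      in-ideal (u , v , u≢v , ¬uv) with proj₂ interpolant u | nonedge∣r u≢v ¬uv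
      ... | a , ax≈ | b , bx≈ = (a + b) Vector.∷ (- b) Vector.∷ Vector.[] , (begin
        f                                     ≈⟨ solve 2 (λ f r → f := (f :- r) :+ r) refl f (r u) ⟩
        (f - r u) + r u                       ≈⟨ +-cong ax≈ bx≈ ⟨
        a * x u + b * (x u - x v)             ≈⟨ solve 4 (λ a b u v → a :* u :+ b :* (u :- v) := (a :+ b) :* u :+ :- b :* v) refl a b (x u) (x v) ⟩
        (a + b) * x u + - b * x v             ≈⟨ +-congˡ (+-identityʳ _) ⟨
        (a + b) * x u + (- b * x v + 0#)      ∎)

    ideal⇒form : ∀ {f} → InCoverIdeal f →
                 ∃ λ η → (∀ i → (η i) R.∈) × Logarithmic η × Corresponds η f
    ideal⇒form {f} f∈J = η , (λ i → reduce∈R i (s i)) , η-logarithmic (λ u v → reduce-agree u v f)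
                       , corresponds (λ i → reduce-near i f)
      where
      r : Vector Carrier n
      r i = reduce i f

      -- Reduction kills `x i` and turns `x j` into `x j - x i`, so only the second term survives.
      nonedge∣r : ∀ i j → i ≢ j → ¬ Adj i j → x j - x i ∣ r i
      nonedge∣r i j i≢j ¬ij with f∈J (i , j , i≢j , ¬ij)
      ... | a , f≈ = reduce i (a (suc zero)) , sym (begin
        reduce i f                                                 ≈⟨ ⟦⟧-cong f≈ ⟩
        reduce i (a zero * x i + (a (suc zero) * x j + 0#))        ≈⟨ ⟦⟧-cong (+-congˡ (+-identityʳ _)) ⟩
        reduce i (a zero * x i + a (suc zero) * x j)               ≈⟨ trans (+-homo _ _) (+-cong (*-homo _ _) (*-homo _ _)) ⟩
        reduce i (a zero) * reduce i (x i) + reduce i (a (suc zero)) * reduce i (x j)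
          ≈⟨ +-cong (trans (*-congˡ (reduce-x i)) (zeroʳ _)) (*-congˡ (substitute-x j)) ⟩
        0# + reduce i (a (suc zero)) * (x j - x i)                 ≈⟨ +-identityˡ _ ⟩
        reduce i (a (suc zero)) * (x j - x i)                      ∎)
        where open Reduce i

      -- The factors of `P i` are pairwise coprime: those at edges divide `Δ`, those at nonedges
      -- divide `r i`.
      P∣Δr : ∀ i → P i ∣ Δ * r i
      P∣Δr i = P-∣ divides
        where
        divides : ∀ j → j ≢ i → x j - x i ∣ Δ * r i
        divides j j≢i with adj? j i
        ... | yes ji = ∣-*ʳ (r i) (edge∣Δ ji)
        ... | no ¬ji = x∣ʳy⇒x∣ʳzy Δ (nonedge∣r i j (j≢i ∘ ≡.sym) (¬ji ∘ symm))

      -- The quotient `s i` comes with no proof of lying in R. Reducing it supplies one and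
      -- preserves the equation, since `P i`, `Δ` and `r i` are in R and hence fixed.
      s η : Vector Carrier n
      s i = _∣ʳ_.quotient (P∣Δr i)
      η i = reduce i (s i)

      Pη≈Δr : ∀ i → P i * η i ≈ Δ * r i
      Pη≈Δr i = begin
        P i * reduce i (s i)             ≈⟨ *-comm _ _ ⟩
        reduce i (s i) * P i             ≈⟨ *-congˡ (reduce-fixes-R i (P∈R i)) ⟨
        reduce i (s i) * reduce i (P i)  ≈⟨ *-homo (s i) (P i) ⟨
        reduce i (s i * P i)             ≈⟨ ⟦⟧-cong (_∣ʳ_.equality (P∣Δr i)) ⟩
        reduce i (Δ * r i)               ≈⟨ reduce-fixes-R i (R.*-∈ Δ∈R (reduce∈R i f)) ⟩
        Δ * r i                          ∎
        where open Reduce i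

      open FromResidues η r Pη≈Δr using (η-logarithmic; corresponds)

    -- Numerators of rational forms

    private
      module Frac = CommutativeRing (Fractions.fractionRing S)

    Q-regular : Regular (Q (graphicArrangement G))
    Q-regular = Regular-resp (sym Q≈Δ) Δ-regular

    numerator-unique : ∀ ω ω′ {η η′} → HasNumerator (graphicArrangement G) ω η → HasNumerator (graphicArrangement G) ω′ η′ →
                       ω Rat.≈ᴹ ω′ → ∀ i → η i ≈ η′ i
    numerator-unique ω ω′ num num′ e i = trans (sym (*-identityʳ _)) (trans (Fractions._≃_.cross
      (Frac.trans (Frac.sym (num i)) (Frac.trans (Frac.*-congˡ {Fractions.ι S (Q (graphicArrangement G))} (e i)) (num′ i))))
      (*-identityʳ _))

    numerator-determines : ∀ ω ω′ {η η′} → HasNumerator (graphicArrangement G) ω η → HasNumerator (graphicArrangement G) ω′ η′ →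
                           (∀ i → η i ≈ η′ i) → ω Rat.≈ᴹ ω′
    numerator-determines ω ω′ p p′ e i = Fractions.mk≃ (Q-regular (begin
      Q (graphicArrangement G) * (num (ω i) * den (ω′ i))          ≈⟨ regroup _ _ ⟨
      (Q (graphicArrangement G) * num (ω i)) * (1# * den (ω′ i))   ≈⟨ Fractions._≃_.cross same ⟩
      (Q (graphicArrangement G) * num (ω′ i)) * (1# * den (ω i))   ≈⟨ regroup _ _ ⟩
      Q (graphicArrangement G) * (num (ω′ i) * den (ω i))          ∎))
      where
      open Fractions S using (num; den; _≃_; ι; _⊛_)
      regroup : ∀ a b → (Q (graphicArrangement G) * a) * (1# * b) ≈ Q (graphicArrangement G) * (a * b)
      regroup a b = trans (*-congˡ (*-identityˡ b)) (*-assoc (Q (graphicArrangement G)) a b)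
      same : (ι (Q (graphicArrangement G)) ⊛ ω i) ≃ (ι (Q (graphicArrangement G)) ⊛ ω′ i)
      same = Frac.trans (p i) (Frac.trans (Fractions.mk≃ (*-congʳ (e i))) (Frac.sym (p′ i)))

    logarithmic : ∀ {η} → All (WedgeDivides η) (graphicArrangement G) → Logarithmic η
    logarithmic {η} w u<v uv = residues η u<v
      (All.lookup w (∈-map⁺ edgeForm (edges-complete u<v uv)))

    wedgesDivide : ∀ {η} → Logarithmic η → All (WedgeDivides η) (graphicArrangement G)
    wedgesDivide {η} log = All.map⁺ (All.map (λ (u<v , uv) → wedgeDivides η u<v (log u<v uv)) edges-sound)

    productIdeal∈ : ∀ {f} → product x ∣ f → Submodule._∈ productIdeal f
    productIdeal∈ (q , qx≈f) = (q Vector.∷ Vector.[]) , sym (trans (+-identityʳ _) qx≈f)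

    productIdeal∣ : ∀ {f} → Submodule._∈ productIdeal f → product x ∣ f
    productIdeal∣ (q , f≈) = q zero , sym (trans f≈ (+-identityʳ _))

    ideal-unique : ∀ {η η′ f f′} → Corresponds η f → Corresponds η′ f′ → (∀ i → η i ≈ η′ i) →
                   Submodule._∈ productIdeal (f - f′)
    ideal-unique p q e =
      productIdeal∈ (corresponds-0⇒∣ (λ i → GP.x≈y⇒x∙y⁻¹≈ε (e i)) (corresponds-- p q))

    numerators-unique : ∀ {η η′ f f′} → (∀ i → (η i) R.∈) → (∀ i → (η′ i) R.∈) →
                        Corresponds η f → Corresponds η′ f′ →
                        Submodule._∈ productIdeal (f - f′) → ∀ i → η i ≈ η′ i
    numerators-unique η∈R η′∈R p q e i = GP.x∙y⁻¹≈ε⇒x≈y _ _ (corresponds-∣⇒0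
      (λ j → R.+-∈ (η∈R j) (R.neg-∈ (η′∈R j))) (corresponds-- p q) (productIdeal∣ e) i)

    -- Membership in the logarithmic forms and membership in the R-forms each carry a numerator of
    -- their own; uniqueness moves the R-membership from one to the other.
    R-numerator : ∀ ω {η η′} → HasNumerator (graphicArrangement G) ω η →
                  HasNumerator (graphicArrangement G) ω η′ → (∀ i → (η′ i) R.∈) → ∀ i → (η i) R.∈
    R-numerator ω num num′ η′∈R i =
      R.resp (numerator-unique ω ω num′ num (λ _ → Frac.refl) i) (η′∈R i)

    _over-Q : Vector Carrier n → Rat.Carrierᴹ
    (η over-Q) i = Fractions.fraction (η i) (Q (graphicArrangement G)) Q-regular

    fraction-numerator : ∀ η → HasNumerator (graphicArrangement G) (η over-Q) η
    fraction-numerator η i = Fractions.mk≃ (solve 3 (λ q h o → (q :* h) :* o := h :* (o :* q)) refl (Q (graphicArrangement G)) (η i) 1#)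

theorem1p5 : ∀ {c ℓ₁ ℓ₂} (K : HeytingField c ℓ₁ ℓ₂) (ℓ : ℕ) (G : SimpleGraph ℓ) →
    let open Arrangements (HeytingCommutativeRing.commutativeRing (HeytingField.heytingCommutativeRing K)) ℓ
    in Ω¹R (graphicArrangement G) ≅ asR-module (J/product (complement G))
theorem1p5 K ℓ G = linearBijection⇒isomorphism (record
  -- The relation reads the numerator stored with the logarithmic condition; the one with entries in
  -- R enters through `R-numerator` in `injective`.
  { _~_ = λ (_ , (η , _) , _) (f , _) → Corresponds G η f
  ; total = λ (_ , (_ , _ , wedges) , _) →
      let f , f∈J , η~f = form⇒ideal G (logarithmic G wedges) in (f , f∈J) , η~f
  ; onto = λ (f , f∈J) →
      let η , η∈R , log , η~f = ideal⇒form G f∈J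
      in ( _over-Q G η
         , (η , fraction-numerator G η , wedgesDivide G log)
         , (η , fraction-numerator G η , η∈R))
       , η~f
  ; ≈-refl = λ i → Fractions.≃-refl _
  ; functional = λ { {ω , (_ , num , _) , _} {ω′ , (_ , num′ , _) , _} p p′ e →
      ideal-unique G p p′ (numerator-unique G ω ω′ num num′ e) }
  ; injective = λ { {ω , (_ , num , _) , _ , numR , ∈R} {ω′ , (_ , num′ , _) , _ , numR′ , ∈R′} p p′ e →
      numerator-determines G ω ω′ num num′
        (numerators-unique G (R-numerator G ω num numR ∈R) (R-numerator G ω′ num′ numR′ ∈R′) p p′ e) }
  ; ~-0 = corresponds-0 G
  ; ~-+ = corresponds-+ G
  ; ~-neg = corresponds-neg G
  ; ~-* = λ (s , _) → corresponds-* G s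
  })
  where open GraphicArrangements (HeytingCommutativeRing.commutativeRing (HeytingField.heytingCommutativeRing K)) ℓ
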